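{- Let $p$ be a prime, $k\ge1$, $q=p^k$. Every integer of the form $$D=AB^{q-1},$$ where $A,B\in\mathbb Z$ satisfy $(q-1)^2\mid A$ and $B\equiv A\pmod q$, is an integer group determinant of $GA(1,q)$.
   Context: For a finite group $G=\{g_1,\dots,g_n\}$ and an element $\sum_{g\in G}a_g g$ of the group ring $\mathbb Z[G]$ (all $a_g\in\mathbb Z$), the group determinant is $D\left(\sum_{g\in G}a_g g\right)=\det\left(a_{g_ig_j^{ -1}}\right)_{i,j=1}^n$. An integer group determinant of $G$ is any integer of this form. The general affine group of degree one over $\mathbb F_q$ is $GA(1,q)=\left\{\begin{pmatrix} a & b\\ 0 & 1\end{pmatrix}: a\in\mathbb F_q^*,\ b\in\mathbb F_q\right\}$ under matrix multiplication. -}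

module Defs where

open import Algebra.Bundles using (CommutativeRing; Group)
import Algebra.Definitions as AlgDefs
import Algebra.Properties.Ring as RingProperties
import Algebra.Properties.Semiring.Sum as SemiringSum
open import Data.Fin.Base using (Fin; zero; suc; toℕ)
open import Data.Integer.Base as ℤ using (ℤ; 1ℤ; -1ℤ)
open import Data.Integer.Properties using (+-*-semiring)
open import Data.Nat.Base using (ℕ; zero; suc)
open import Data.Product.Base using (∃; ∃-syntax; _×_; _,_)
open import Data.Vec.Functional using (Vector; removeAt)
open import Function.Bundles using (Func; Inverse)
open import Level using (Level; _⊔_)
import Level
open import Relation.Binary.Bundles using (Setoid)
open import Relation.Binary.PropositionalEquality using (_≡_)
import Relation.Binary.PropositionalEquality as ≡
import Relation.Binary.Reasoning.Setoid as SetoidReasoning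

private
  variable
    a c ℓ : Level
    n : ℕ

Matrix : Set a → ℕ → ℕ → Set a
Matrix A m n = Vector (Vector A n) m

-- Laplace expansion along the first row.
det : Matrix ℤ n n → ℤ
det {zero}  M = 1ℤ
det {suc n} M = sum λ j →
  (-1ℤ ℤ.^ toℕ j) ℤ.* M zero j ℤ.* det (λ i → removeAt (M (suc i)) j)
  where open SemiringSum +-*-semiring using (sum)

Enumeration : ℕ → Setoid c ℓ → Set (c ⊔ ℓ)
Enumeration n S = Inverse (≡.setoid (Fin n)) S

module _ (G : Group c ℓ) where
  open Group G using (setoid; _∙_; _⁻¹)

  -- For finite G the elements of ℤ[G] are exactly the coefficient functions
  -- G → ℤ that respect the equality of G.
  GroupRing : Set (c ⊔ ℓ)
  GroupRing = Func setoid (≡.setoid ℤ)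

  groupMatrix : Enumeration n setoid → GroupRing → Matrix ℤ n n
  groupMatrix enum α i j = α.to (g i ∙ (g j) ⁻¹)
    where
    module α = Func α
    g = Inverse.to enum

  groupDeterminant : Enumeration n setoid → GroupRing → ℤ
  groupDeterminant enum α = det (groupMatrix enum α)

  -- Another enumeration conjugates the group matrix by a permutation matrix,
  -- so the determinants obtained do not depend on the choice of enumeration.
  IsIntegerGroupDeterminant : ℤ → Set (c ⊔ ℓ)
  IsIntegerGroupDeterminant D =
    ∃[ n ] ∃ λ (enum : Enumeration n setoid) → ∃[ α ] D ≡ groupDeterminant enum α

record FiniteField (c ℓ : Level) (q : ℕ) : Set (Level.suc (c ⊔ ℓ)) where
  field
    commutativeRing : CommutativeRing c ℓ

  open CommutativeRing commutativeRing public

  open AlgDefs _≈_ using (Invertible)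

  field
    0≉1         : 0# ≉ 1#
    invertible  : ∀ {x} → x ≉ 0# → Invertible 1# _*_ x
    enumeration : Enumeration q setoid

module _ {q : ℕ} (F : FiniteField c ℓ q) where
  open FiniteField F hiding (zero)
  open RingProperties ring using (-‿distribʳ-*)
  open SetoidReasoning setoid

  -- The affine map x ↦ slope * x + shift.
  record Affine : Set (c ⊔ ℓ) where
    constructor affine
    field
      slope   : Carrier
      shift   : Carrier
      slope≉0 : slope ≉ 0#

  open Affine

  toMatrix : Affine → Matrix Carrier 2 2
  toMatrix g zero       zero       = slope g
  toMatrix g zero       (suc zero) = shift g
  toMatrix g (suc zero) zero       = 0#
  toMatrix g (suc zero) (suc zero) = 1#

  private
    leftInvertible⇒≉0 : ∀ {x y} → x * y ≈ 1# → x ≉ 0#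
    leftInvertible⇒≉0 {x} {y} xy≈1 x≈0 = 0≉1 (begin
      0#      ≈⟨ zeroˡ y ⟨
      0# * y  ≈⟨ *-congʳ x≈0 ⟨
      x * y   ≈⟨ xy≈1 ⟩
      1#      ∎)

    *-≉0 : ∀ {x y} → x ≉ 0# → y ≉ 0# → x * y ≉ 0#
    *-≉0 {x} {y} x≉0 y≉0 xy≈0 with invertible x≉0
    ... | x⁻¹ , x⁻¹x≈1 , _ = y≉0 (begin
      y              ≈⟨ *-identityˡ y ⟨
      1# * y         ≈⟨ *-congʳ x⁻¹x≈1 ⟨
      x⁻¹ * x * y    ≈⟨ *-assoc x⁻¹ x y ⟩
      x⁻¹ * (x * y)  ≈⟨ *-congˡ xy≈0 ⟩
      x⁻¹ * 0#       ≈⟨ zeroʳ x⁻¹ ⟩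
      0#             ∎)

  infixl 7 _∘ᴬ_
  infix 4 _≈ᴬ_

  _≈ᴬ_ : Affine → Affine → Set ℓ
  g ≈ᴬ h = slope g ≈ slope h × shift g ≈ shift h

  _∘ᴬ_ : Affine → Affine → Affine
  g ∘ᴬ h = affine (slope g * slope h) (slope g * shift h + shift g)
                  (*-≉0 (slope≉0 g) (slope≉0 h))

  toMatrix-∘ᴬ : ∀ g h i j → toMatrix (g ∘ᴬ h) i j ≈
    toMatrix g i zero * toMatrix h zero j + toMatrix g i (suc zero) * toMatrix h (suc zero) j
  toMatrix-∘ᴬ g h zero zero = sym (begin
    slope g * slope h + shift g * 0#  ≈⟨ +-congˡ (zeroʳ _) ⟩
    slope g * slope h + 0#            ≈⟨ +-identityʳ _ ⟩
    slope g * slope h                 ∎)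
  toMatrix-∘ᴬ g h zero (suc zero) = +-congˡ (sym (*-identityʳ _))
  toMatrix-∘ᴬ g h (suc zero) zero = sym (begin
    0# * slope h + 1# * 0#  ≈⟨ +-cong (zeroˡ _) (zeroʳ _) ⟩
    0# + 0#                 ≈⟨ +-identityˡ 0# ⟩
    0#                      ∎)
  toMatrix-∘ᴬ g h (suc zero) (suc zero) = sym (begin
    0# * shift h + 1# * 1#  ≈⟨ +-cong (zeroˡ _) (*-identityˡ 1#) ⟩
    0# + 1#                 ≈⟨ +-identityˡ 1# ⟩
    1#                      ∎)

  idᴬ : Affine
  idᴬ = affine 1# 0# (λ 1≈0 → 0≉1 (sym 1≈0))

  _⁻¹ᴬ : Affine → Affine
  g ⁻¹ᴬ with invertible (slope≉0 g)
  ... | a⁻¹ , a⁻¹a≈1 , _ = affine a⁻¹ (- (a⁻¹ * shift g)) (leftInvertible⇒≉0 a⁻¹a≈1)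

  private
    ∘ᴬ-assoc : ∀ g h k → (g ∘ᴬ h) ∘ᴬ k ≈ᴬ g ∘ᴬ (h ∘ᴬ k)
    ∘ᴬ-assoc (affine a b _) (affine a′ b′ _) (affine a″ b″ _) = *-assoc a a′ a″ , (begin
      a * a′ * b″ + (a * b′ + b)    ≈⟨ +-assoc _ _ _ ⟨
      a * a′ * b″ + a * b′ + b      ≈⟨ +-congʳ (+-congʳ (*-assoc a a′ b″)) ⟩
      a * (a′ * b″) + a * b′ + b    ≈⟨ +-congʳ (distribˡ a _ _) ⟨
      a * (a′ * b″ + b′) + b        ∎)

    ∘ᴬ-identityˡ : ∀ g → idᴬ ∘ᴬ g ≈ᴬ g
    ∘ᴬ-identityˡ (affine a b _) =
      *-identityˡ a , trans (+-identityʳ _) (*-identityˡ b)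

    ∘ᴬ-identityʳ : ∀ g → g ∘ᴬ idᴬ ≈ᴬ g
    ∘ᴬ-identityʳ (affine a b _) =
      *-identityʳ a , trans (+-congʳ (zeroʳ a)) (+-identityˡ b)

    ∘ᴬ-inverseˡ : ∀ g → (g ⁻¹ᴬ) ∘ᴬ g ≈ᴬ idᴬ
    ∘ᴬ-inverseˡ g with invertible (slope≉0 g)
    ... | a⁻¹ , a⁻¹a≈1 , _ = a⁻¹a≈1 , -‿inverseʳ _

    ∘ᴬ-inverseʳ : ∀ g → g ∘ᴬ (g ⁻¹ᴬ) ≈ᴬ idᴬ
    ∘ᴬ-inverseʳ g@(affine a b _) with invertible (slope≉0 g)
    ... | a⁻¹ , _ , aa⁻¹≈1 = aa⁻¹≈1 , (begin
      a * (- (a⁻¹ * b)) + b  ≈⟨ +-congʳ (-‿distribʳ-* a _) ⟨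
      - (a * (a⁻¹ * b)) + b  ≈⟨ +-congʳ (-‿cong (*-assoc a a⁻¹ b)) ⟨
      - (a * a⁻¹ * b) + b    ≈⟨ +-congʳ (-‿cong (*-congʳ aa⁻¹≈1)) ⟩
      - (1# * b) + b         ≈⟨ +-congʳ (-‿cong (*-identityˡ b)) ⟩
      - b + b                ≈⟨ -‿inverseˡ b ⟩
      0#                     ∎)

    -- Congruence of inversion follows from uniqueness of inverses.
    ⁻¹-unique : ∀ {x y u v} → x ≈ y → u * x ≈ 1# → y * v ≈ 1# → u ≈ v
    ⁻¹-unique {x} {y} {u} {v} x≈y ux≈1 yv≈1 = begin
      u            ≈⟨ *-identityʳ u ⟨
      u * 1#       ≈⟨ *-congˡ yv≈1 ⟨
      u * (y * v)  ≈⟨ *-assoc u y v ⟨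
      u * y * v    ≈⟨ *-congʳ (*-congˡ x≈y) ⟨
      u * x * v    ≈⟨ *-congʳ ux≈1 ⟩
      1# * v       ≈⟨ *-identityˡ v ⟩
      v            ∎

    ⁻¹ᴬ-cong : ∀ {g h} → g ≈ᴬ h → g ⁻¹ᴬ ≈ᴬ h ⁻¹ᴬ
    ⁻¹ᴬ-cong {g} {h} (a≈a′ , b≈b′)
      with invertible (slope≉0 g) | invertible (slope≉0 h)
    ... | u , ua≈1 , _ | v , _ , a′v≈1 = u≈v , -‿cong (*-cong u≈v b≈b′)
      where u≈v = ⁻¹-unique a≈a′ ua≈1 a′v≈1

  GA₁ : Group (c ⊔ ℓ) ℓ
  GA₁ = record
    { Carrier = Affine
    ; _≈_     = _≈ᴬ_
    ; _∙_     = _∘ᴬ_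
    ; ε       = idᴬ
    ; _⁻¹     = _⁻¹ᴬ
    ; isGroup = record
      { isMonoid = record
        { isSemigroup = record
          { isMagma = record
            { isEquivalence = record
              { refl  = refl , refl
              ; sym   = λ (p , q) → sym p , sym q
              ; trans = λ (p , q) (p′ , q′) → trans p p′ , trans q q′
              }
            ; ∙-cong = λ (p , q) (p′ , q′) → *-cong p p′ , +-cong (*-cong p q′) q
            }
          ; assoc = ∘ᴬ-assoc
          }
        ; identity = ∘ᴬ-identityˡ , ∘ᴬ-identityʳ
        }
      ; inverse = ∘ᴬ-inverseˡ , ∘ᴬ-inverseʳ
      ; ⁻¹-cong = ⁻¹ᴬ-cong
      }
    }

{-# OPTIONS --safe #-}
module Submission where

-- Let N = q − 1 and let g generate F^×, viewed in GA(1,q) as x ↦ g x. For α = 1 − g + u T₁ + v T₀,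
-- with T_y the sum of the affine maps sending y to 1, the group matrix is S + U K: here S is the
-- matrix of 1 − g, block diagonal with one cyclic block of size N for each root r (the maps
-- x ↦ gⁱ (x − r)), and U and K have inner dimension q because T_y has coefficient Σ_z [k z = 1] [h z = y]
-- at k h⁻¹. The rows and the columns of S sum to zero over each block, which leaves
-- det (S + U K) = det Û · det K̂ with Û and K̂ the q × q matrices of block sums of U and K. These are
-- Û = J − 1 and K̂ = u J + (N v − u), J being the all-ones matrix, and hence the determinant is
-- N² (u + v) (u − N v) ^ N.

open import Defs
open import Algebra.Bundles using (Group)
open import Data.Bool.Base using (if_then_else_)
open import Data.Fin.Base as Fin using
  (Fin; zero; suc; toℕ; inject≤; punchIn; _↑ˡ_; _↑ʳ_; combine; remQuot; splitAt)
import Data.Fin.Properties as Fin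
import Data.List.Base as List
import Data.List.Relation.Unary.All as All
open import Data.Nat.Base as ℕ using (ℕ; zero; suc; _∸_; _≥_)
import Data.Nat.Divisibility as ℕ
open import Data.Nat.GCD using (gcd; gcd[m,n]∣m; gcd[m,n]∣n; gcd-GCD; module Bézout)
open import Data.Nat.Induction using (<-rec)
open import Data.Nat.ListAction using (product)
open import Data.Nat.Primality using
  ( Prime; prime?; ¬prime[1]; prime⇒irreducible; prime⇒nonTrivial; prime⇒nonZero; euclidsLemma )
open import Data.Nat.Primality.Factorisation using (factorise)
import Data.Nat.Properties as ℕ
open import Data.Product.Base using (∃; _×_; _,_; proj₁; proj₂; map₁)
open import Data.Sum.Base using (_⊎_; inj₁; inj₂; [_,_]′)
open import Data.Unit.Base using (⊤; tt)
open import Data.Vec.Functional using (Vector; _∷_; head; tail; removeAt; insertAt)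
open import Data.Vec.Functional.Properties using (insertAt-lookup; insertAt-punchIn)
open import Function.Base using (_∘_; flip)
open import Function.Bundles using (Inverse)
open import Function.Properties.Bijection using (Bijection⇒Inverse)
open import Level using (Level; _⊔_)
open import Relation.Binary.Definitions using (tri<; tri≈; tri>)
open import Relation.Binary.PropositionalEquality as ≡ using (_≡_; _≢_)
open import Relation.Nullary using (Dec; does; yes; no; ¬_; contradiction)
open import Relation.Nullary.Decidable using (map′; _×-dec_; ¬?; decidable-stable)

-- The choice of α is guided by the representations of GA(1,q): N linear characters χ, which see
-- only the slope, and one irreducible representation of degree N. Each T_y contains exactly one map
-- of every slope, so a nontrivial χ sends α to 1 - χ(g) and the trivial one sends it to N (u + v).
-- As g generates F^×, the values 1 - χ(g) multiply to N, which accounts for N² (u + v); the N-th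
-- power is the share of the representation of degree N. Integer row and column operations take the
-- place of characters, so that the computation never leaves ℤ. A generator also makes S
-- unitriangular once index 0 is deleted from each cyclic block. This is why S leaves no factor of
-- its own, and why cyclicity of F^× has to be established. The congruence is built in: u - N v = (u
-- + v) - q v and N² ≡ 1 modulo q, so N² (u + v) ≡ u - N v, and varying v with u + v fixed reaches
-- every B in the class.

primeDivisor : ∀ m → 1 ℕ.< m → ∃ λ r → Prime r × r ℕ.∣ m
primeDivisor m@(suc _) 1<m with factorise m
... | record { factors = List.[]      ; isFactorisation = m≡1 } = contradiction (≡.sym m≡1) (ℕ.<⇒≢ 1<m)
... | record { factors = r List.∷ rs ; isFactorisation = m≡r*rs ; factorsPrime = r-prime All.∷ _ } =
  r , r-prime , ℕ.divides (product rs) (≡.trans m≡r*rs (ℕ.*-comm r (product rs)))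

prime∣prime⇒≡ : ∀ {r s} → Prime r → Prime s → s ℕ.∣ r → s ≡ r
prime∣prime⇒≡ r-prime s-prime s∣r with prime⇒irreducible r-prime s∣r
... | inj₁ ≡.refl = contradiction s-prime ¬prime[1]
... | inj₂ s≡r    = s≡r

-- Divide by `r` until it no longer divides. Of the result only the prime divisors are recorded: in
-- `avoids` it is enough that every other prime `s` of `e` divides `e′`, for then `e′ · (e / s)` is
-- a multiple of `e`.
removePrime : ∀ {r} → Prime r → ∀ e → 0 ℕ.< e →
  ∃ λ e′ → ¬ r ℕ.∣ e′ × (∀ {s} → Prime s → s ≢ r → s ℕ.∣ e → s ℕ.∣ e′)
removePrime {r} r-prime = <-rec _ go
  where
  1<r = ℕ.nonTrivial⇒n>1 r {{prime⇒nonTrivial r-prime}}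
  go : ∀ e → (∀ {d} → d ℕ.< e → 0 ℕ.< d → _) → 0 ℕ.< e →
       ∃ λ e′ → ¬ r ℕ.∣ e′ × (∀ {s} → Prime s → s ≢ r → s ℕ.∣ e → s ℕ.∣ e′)
  go e rec 0<e with r ℕ.∣? e
  ... | no r∤e = e , r∤e , λ _ _ s∣e → s∣e
  ... | yes (ℕ.divides zero ≡.refl) = contradiction 0<e ℕ.n≮0
  ... | yes (ℕ.divides m@(suc _) ≡.refl) with rec (ℕ.m<m*n m r 1<r) ℕ.z<s
  ...   | e′ , r∤e′ , keeps = e′ , r∤e′ , λ s-prime s≢r s∣mr →
    keeps s-prime s≢r (factor s-prime s≢r (euclidsLemma m r s-prime s∣mr))
    where
    factor : ∀ {s} → Prime s → s ≢ r → s ℕ.∣ m ⊎ s ℕ.∣ r → s ℕ.∣ m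
    factor s-prime s≢r (inj₁ s∣m) = s∣m
    factor s-prime s≢r (inj₂ s∣r) = contradiction (prime∣prime⇒≡ r-prime s-prime s∣r) s≢r

-- Finite fields: powers, monic polynomial functions and the exponent of the unit group

module FieldProperties {c ℓ : Level} {q : ℕ} (F : FiniteField c ℓ q) where
  open FiniteField F hiding (zero)
  open import Algebra.Properties.CommutativeSemiring.Exp commutativeSemiring
    using (_^_; ^-congˡ; ^-congʳ; ^-homo-*; ^-assocʳ; ^-distrib-*)
  open import Algebra.Properties.Group +-group using (∙-cancelˡ)
  open import Algebra.Solver.Ring.NaturalCoefficients.Default commutativeSemiring
    using (solve; _:+_; _:*_; _:=_)
  open import Relation.Binary.Reasoning.Setoid setoid

  element : Fin q → Carrier
  element = Inverse.to enumeration

  index : Carrier → Fin q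
  index = Inverse.from enumeration

  element-index : ∀ x → element (index x) ≈ x
  element-index x = Inverse.strictlyInverseˡ enumeration x

  index-element : ∀ i → index (element i) ≡ i
  index-element i = Inverse.strictlyInverseʳ enumeration i

  index-cong : ∀ {x y} → x ≈ y → index x ≡ index y
  index-cong = Inverse.from-cong enumeration

  index-injective : ∀ {x y} → index x ≡ index y → x ≈ y
  index-injective {x} {y} eq = begin
    x                  ≈⟨ element-index x ⟨
    element (index x)  ≡⟨ ≡.cong element eq ⟩
    element (index y)  ≈⟨ element-index y ⟩
    y                  ∎

  element-injective : ∀ {i j} → element i ≈ element j → i ≡ j
  element-injective {i} {j} eq =
    ≡.trans (≡.sym (index-element i)) (≡.trans (index-cong eq) (index-element j))

  infix 4 _≟_
  _≟_ : ∀ x y → Dec (x ≈ y)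
  x ≟ y = map′ index-injective index-cong (index x Fin.≟ index y)

  1≉0 : 1# ≉ 0#
  1≉0 = 0≉1 ∘ sym

  *-cancelˡ : ∀ {a x y} → a ≉ 0# → a * x ≈ a * y → x ≈ y
  *-cancelˡ {a} {x} {y} a≉0 ax≈ay with invertible a≉0
  ... | b , ba≈1 , _ = begin
    x            ≈⟨ *-identityˡ x ⟨
    1# * x       ≈⟨ *-congʳ ba≈1 ⟨
    b * a * x    ≈⟨ *-assoc b a x ⟩
    b * (a * x)  ≈⟨ *-congˡ ax≈ay ⟩
    b * (a * y)  ≈⟨ *-assoc b a y ⟨
    b * a * y    ≈⟨ *-congʳ ba≈1 ⟩
    1# * y       ≈⟨ *-identityˡ y ⟩
    y            ∎

  *-≉0 : ∀ {x y} → x ≉ 0# → y ≉ 0# → x * y ≉ 0#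
  *-≉0 x≉0 y≉0 xy≈0 = y≉0 (*-cancelˡ x≉0 (trans xy≈0 (sym (zeroʳ _))))

  ^-≉0 : ∀ {x} → x ≉ 0# → ∀ m → x ^ m ≉ 0#
  ^-≉0 x≉0 zero    = 1≉0
  ^-≉0 x≉0 (suc m) = *-≉0 x≉0 (^-≉0 x≉0 m)

  1^m≈1 : ∀ m → 1# ^ m ≈ 1#
  1^m≈1 zero    = refl
  1^m≈1 (suc m) = trans (*-identityˡ _) (1^m≈1 m)

  ^-∣ : ∀ {x d m} → d ℕ.∣ m → x ^ d ≈ 1# → x ^ m ≈ 1#
  ^-∣ {x} {d} (ℕ.divides k ≡.refl) xᵈ≈1 = begin
    x ^ (k ℕ.* d)  ≈⟨ ^-congʳ x (ℕ.*-comm k d) ⟩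
    x ^ (d ℕ.* k)  ≈⟨ ^-assocʳ x d k ⟨
    (x ^ d) ^ k    ≈⟨ ^-congˡ k xᵈ≈1 ⟩
    1# ^ k         ≈⟨ 1^m≈1 k ⟩
    1#             ∎

  private
    -- A Bézout relation with its negative term moved to the other side, which keeps all exponents
    -- natural.
    ^-combination : ∀ {x} d {m n} a b → d ℕ.+ b ℕ.* n ≡ a ℕ.* m → x ^ m ≈ 1# → x ^ n ≈ 1# → x ^ d ≈ 1#
    ^-combination {x} d {m} {n} a b eq xᵐ≈1 xⁿ≈1 = begin
      x ^ d                  ≈⟨ *-identityʳ _ ⟨
      x ^ d * 1#             ≈⟨ *-congˡ (^-∣ (ℕ.n∣m*n b) xⁿ≈1) ⟨
      x ^ d * x ^ (b ℕ.* n)  ≈⟨ ^-homo-* x d (b ℕ.* n) ⟨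
      x ^ (d ℕ.+ b ℕ.* n)    ≈⟨ ^-congʳ x eq ⟩
      x ^ (a ℕ.* m)          ≈⟨ ^-∣ (ℕ.n∣m*n a) xᵐ≈1 ⟩
      1#                     ∎

  ^-gcd : ∀ {x} m n → x ^ m ≈ 1# → x ^ n ≈ 1# → x ^ gcd m n ≈ 1#
  ^-gcd m n xᵐ≈1 xⁿ≈1 with Bézout.identity (gcd-GCD m n)
  ... | Bézout.Identity.+- a b d+bn≡am = ^-combination (gcd m n) a b d+bn≡am xᵐ≈1 xⁿ≈1
  ... | Bézout.Identity.-+ a b d+am≡bn = ^-combination (gcd m n) b a d+am≡bn xⁿ≈1 xᵐ≈1

  -- Polynomial functions that are monic of degree d, characterised by their difference
  -- quotients: f x − f a = (x − a) g x with g monic of degree d − 1.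
  Monic : ℕ → (Carrier → Carrier) → Set (c ⊔ ℓ)
  Monic zero    f = ∀ x → f x ≈ 1#
  Monic (suc d) f = ∀ a → ∃ λ g → Monic d g × (∀ x → f x + a * g x ≈ f a + x * g x)

  -- A summand of lower degree leaves the leading coefficient alone. Difference quotients are
  -- additive, so the claim descends to degree zero, where `g` is constant.
  monic-+ : ∀ d {f g} → Monic (suc d) f → Monic d g → ∀ b → Monic (suc d) (λ x → f x + b * g x)
  monic-+ zero {f} {g} f-monic g≈1 b a with f-monic a
  ... | f′ , f′-monic , eq = f′ , f′-monic , λ x → begin
    f x + b * g x + a * f′ x    ≈⟨ solve 3 (λ u v w → u :+ v :+ w := (u :+ w) :+ v) refl (f x) (b * g x) (a * f′ x) ⟩
    f x + a * f′ x + b * g x    ≈⟨ +-cong (eq x) (*-congˡ (trans (g≈1 x) (sym (g≈1 a)))) ⟩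
    f a + x * f′ x + b * g a    ≈⟨ solve 3 (λ u v w → u :+ v :+ w := (u :+ w) :+ v) refl (f a) (x * f′ x) (b * g a) ⟩
    f a + b * g a + x * f′ x    ∎
  monic-+ (suc d) {f} {g} f-monic g-monic b a with f-monic a | g-monic a
  ... | f′ , f′-monic , f-eq | g′ , g′-monic , g-eq =
    (λ x → f′ x + b * g′ x) , monic-+ d f′-monic g′-monic b , λ x → begin
      f x + b * g x + a * (f′ x + b * g′ x)      ≈⟨ regroup (f x) b (g x) a (f′ x) (g′ x) ⟩
      f x + a * f′ x + b * (g x + a * g′ x)      ≈⟨ +-cong (f-eq x) (*-congˡ (g-eq x)) ⟩
      f a + x * f′ x + b * (g a + x * g′ x)      ≈⟨ regroup (f a) b (g a) x (f′ x) (g′ x) ⟨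
      f a + b * g a + x * (f′ x + b * g′ x)      ∎
    where
    regroup = solve 6 (λ u b v a u′ v′ →
      u :+ b :* v :+ a :* (u′ :+ b :* v′) := u :+ a :* u′ :+ b :* (v :+ a :* v′)) refl

  -- The difference quotient of `x * f x` at `a` is `f x + a * g x`, with `g` that of `f`; it is
  -- monic by `monic-+`.
  monic-x* : ∀ d {f} → Monic d f → Monic (suc d) (λ x → x * f x)
  monic-x* zero {f} f≈1 a = f , f≈1 , λ x → begin
    x * f x + a * f x  ≈⟨ +-comm _ _ ⟩
    a * f x + x * f x  ≈⟨ +-congʳ (*-congˡ (trans (f≈1 x) (sym (f≈1 a)))) ⟩
    a * f a + x * f x  ∎
  monic-x* (suc d) {f} f-monic a with f-monic a
  ... | g , g-monic , eq = (λ x → f x + a * g x) , monic-+ d f-monic g-monic a , λ x → begin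
    x * f x + a * (f x + a * g x)  ≈⟨ +-congˡ (*-congˡ (eq x)) ⟩
    x * f x + a * (f a + x * g x)  ≈⟨ solve 5 (λ x u a v g →
                                        x :* u :+ a :* (v :+ x :* g) := a :* v :+ x :* (u :+ a :* g))
                                        refl x (f x) a (f a) (g x) ⟩
    a * f a + x * (f x + a * g x)  ∎

  monic-^ : ∀ d → Monic d (_^ d)
  monic-^ zero    x = refl
  monic-^ (suc d) = monic-x* d (monic-^ d)

  -- Since `f` takes one value on all the points, its difference quotient at the first point
  -- vanishes at every other one, and it has one degree less; the descent ends at the constant 1,
  -- which has no zero. With a general value `b`, the bound applies directly to the equation
  -- `x ^ e ≈ 1`.
  monic-rootBound : ∀ d {f} → Monic (suc d) f → (v : Fin (suc (suc d)) → Carrier) →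
                    (∀ {i j} → v i ≈ v j → i ≡ j) → ∀ b → ¬ (∀ i → f (v i) ≈ b)
  monic-rootBound d {f} f-monic v v-inj b f≈b with f-monic (v zero)
  ... | g , g-monic , eq = conclude d g-monic (v ∘ suc) (Fin.suc-injective ∘ v-inj) g≈0
    where
    g≈0 : ∀ i → g (v (suc i)) ≈ 0#
    g≈0 i with g (v (suc i)) ≟ 0#
    ... | yes g≈0 = g≈0
    ... | no g≉0 = contradiction (v-inj {zero} {suc i} (*-cancelˡ g≉0 (begin
      g y * v zero  ≈⟨ *-comm _ _ ⟩
      v zero * g y  ≈⟨ ∙-cancelˡ b _ _ (begin
        b + v zero * g y           ≈⟨ +-congʳ (f≈b (suc i)) ⟨
        f y + v zero * g y         ≈⟨ eq y ⟩
        f (v zero) + y * g y       ≈⟨ +-congʳ (f≈b zero) ⟩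
        b + y * g y                ∎) ⟩
      y * g y       ≈⟨ *-comm _ _ ⟩
      g y * y       ∎))) Fin.0≢1+n
      where y = v (suc i)
    conclude : ∀ d {g} → Monic d g → (w : Fin (suc d) → Carrier) →
               (∀ {i j} → w i ≈ w j → i ≡ j) → ¬ (∀ i → g (w i) ≈ 0#)
    conclude zero    g≈1     w _     g≈0 = 1≉0 (trans (sym (g≈1 (w zero))) (g≈0 zero))
    conclude (suc d) g-monic w w-inj g≈0 = monic-rootBound d g-monic w w-inj 0# g≈0

  ^-cancel : ∀ {x i j} → x ≉ 0# → i ℕ.≤ j → x ^ i ≈ x ^ j → x ^ (j ℕ.∸ i) ≈ 1#
  ^-cancel {x} {i} {j} x≉0 i≤j xⁱ≈xʲ = *-cancelˡ (^-≉0 x≉0 i) (begin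
    x ^ i * x ^ (j ℕ.∸ i)    ≈⟨ ^-homo-* x i (j ℕ.∸ i) ⟨
    x ^ (i ℕ.+ (j ℕ.∸ i))    ≈⟨ ^-congʳ x (ℕ.m+[n∸m]≡n i≤j) ⟩
    x ^ j                    ≈⟨ xⁱ≈xʲ ⟨
    x ^ i                    ≈⟨ *-identityʳ _ ⟨
    x ^ i * 1#               ∎)

  Exponent : ℕ → Set (c ⊔ ℓ)
  Exponent e = ∀ x → x ≉ 0# → x ^ e ≈ 1#

  exponent-or-witness : ∀ e → Exponent e ⊎ ∃ λ x → x ≉ 0# × ¬ x ^ e ≈ 1#
  exponent-or-witness e with Fin.any? (λ i → ¬? (element i ≟ 0#) ×-dec ¬? (element i ^ e ≟ 1#))
  ... | yes (i , x≉0 , xᵉ≉1) = inj₂ (element i , x≉0 , xᵉ≉1)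
  ... | no none = inj₁ λ x x≉0 → decidable-stable (x ^ e ≟ 1#) λ xᵉ≉1 → none
    (index x , (λ eq → x≉0 (trans (sym (element-index x)) eq))
             , (λ eq → xᵉ≉1 (trans (^-congˡ e (sym (element-index x))) eq)))

  exponent? : ∀ e → Dec (Exponent e)
  exponent? e with exponent-or-witness e
  ... | inj₁ exp              = yes exp
  ... | inj₂ (x , x≉0 , xᵉ≉1) = no λ exp → xᵉ≉1 (exp x x≉0)

  -- Among the q + 1 powers x⁰, ..., x^q two coincide, so some positive power with exponent at most
  -- q is 1, and that exponent divides q!. Any common exponent would do as the start of the descent
  -- to the least one.
  exponent-! : Exponent (q ℕ.!)
  exponent-! x x≉0 with Fin.pigeonhole (ℕ.n<1+n q) (λ i → index (x ^ toℕ i))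
  ... | i , j , i<j , eq = ^-∣ (k∣q! (toℕ j ℕ.∸ toℕ i) (ℕ.m<n⇒0<n∸m i<j) k≤q)
    (^-cancel x≉0 (ℕ.<⇒≤ i<j) (index-injective eq))
    where
    k≤q : toℕ j ℕ.∸ toℕ i ℕ.≤ q
    k≤q = ℕ.≤-trans (ℕ.m∸n≤m (toℕ j) (toℕ i)) (Fin.toℕ≤pred[n] j)
    k∣q! : ∀ k → 0 ℕ.< k → k ℕ.≤ q → k ℕ.∣ q ℕ.!
    k∣q! (suc k) _ k<q = ℕ.∣-trans (ℕ.m∣m*n (k ℕ.!)) (ℕ.m≤n⇒m!∣n! k<q)

  LeastExponent : ℕ → Set (c ⊔ ℓ)
  LeastExponent e = 0 ℕ.< e × Exponent e × (∀ m → 0 ℕ.< m → m ℕ.< e → ¬ Exponent m)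

  leastExponent : ∃ LeastExponent
  leastExponent = <-rec (λ e → 0 ℕ.< e → Exponent e → ∃ LeastExponent) go (q ℕ.!) (ℕ.1≤n! q) exponent-!
    where
    go : ∀ e → (∀ {m} → m ℕ.< e → 0 ℕ.< m → Exponent m → ∃ LeastExponent) → 0 ℕ.< e → Exponent e → ∃ LeastExponent
    go e rec 0<e exp with ℕ.anyUpTo? (λ m → (0 ℕ.<? m) ×-dec exponent? m) e
    ... | yes (m , m<e , 0<m , exp-m) = rec m<e 0<m exp-m
    ... | no none = e , 0<e , exp , λ m 0<m m<e exp-m → none (m , m<e , 0<m , exp-m)

  -- For an exponent `e` and `b` above all prime divisors of `e`, this says that `g` has order
  -- exactly `e`. The bound `b` allows treating one prime at a time.
  Avoids : ℕ → ℕ → Carrier → Set ℓ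
  Avoids e b g = ∀ r m → Prime r → r ℕ.< b → e ≡ m ℕ.* r → g ^ m ≉ 1#

  -- If g fails at the prime b, multiply it by x ^ e′ where x ^ (e / b) ≉ 1 and e′ is e stripped of b:
  -- this repairs b and does not affect the other primes.
  avoids : ∀ {e} → LeastExponent e → ∀ b → ∃ λ g → g ≉ 0# × Avoids e b g
  avoids least zero = 1# , 1≉0 , λ _ _ _ ()
  avoids {e} least@(0<e , exp , minimal) (suc b) with avoids least b | prime? b | b ℕ.∣? e
  ... | g , g≉0 , av | no b-notPrime | _ = g , g≉0 , extend
    where
    extend : Avoids e (suc b) g
    extend r m r-prime r<1+b eq with ℕ.m<1+n⇒m<n∨m≡n r<1+b
    ... | inj₁ r<b    = av r m r-prime r<b eq
    ... | inj₂ ≡.refl = contradiction r-prime b-notPrime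
  ... | g , g≉0 , av | yes _ | no b∤e = g , g≉0 , extend
    where
    extend : Avoids e (suc b) g
    extend r m r-prime r<1+b eq with ℕ.m<1+n⇒m<n∨m≡n r<1+b
    ... | inj₁ r<b    = av r m r-prime r<b eq
    ... | inj₂ ≡.refl = contradiction (ℕ.divides m eq) b∤e
  ... | g , g≉0 , av | yes b-prime | yes (ℕ.divides m e≡mb) with g ^ m ≟ 1#
  ...   | no gᵐ≉1 = g , g≉0 , extend
    where
    extend : Avoids e (suc b) g
    extend r m′ r-prime r<1+b eq with ℕ.m<1+n⇒m<n∨m≡n r<1+b
    ... | inj₁ r<b    = av r m′ r-prime r<b eq
    ... | inj₂ ≡.refl with ℕ.*-cancelʳ-≡ m′ m b {{prime⇒nonZero b-prime}} (≡.trans (≡.sym eq) e≡mb)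
    ...   | ≡.refl = gᵐ≉1
  ...   | yes gᵐ≈1 with exponent-or-witness m | removePrime b-prime e 0<e
  -- Here `m` is e / b, smaller than the least exponent, so some unit `x` must have `x ^ m ≉ 1`.
  ...     | inj₁ exp-m | _ = contradiction exp-m (minimal m 0<m m<e)
    where
    0<m : 0 ℕ.< m
    0<m = ℕ.n≢0⇒n>0 λ { ≡.refl → ℕ.<⇒≢ 0<e (≡.sym e≡mb) }
    m<e : m ℕ.< e
    m<e = ≡.subst (m ℕ.<_) (≡.sym e≡mb)
      (ℕ.m<m*n m b {{ℕ.>-nonZero 0<m}} (ℕ.nonTrivial⇒n>1 b {{prime⇒nonTrivial b-prime}}))
  ...     | inj₂ (x , x≉0 , xᵐ≉1) | e′ , b∤e′ , keeps = g * x ^ e′ , *-≉0 g≉0 (^-≉0 x≉0 e′) , extend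
    where
    expand : ∀ k → (g * x ^ e′) ^ k ≈ g ^ k * x ^ (e′ ℕ.* k)
    expand k = trans (^-distrib-* g (x ^ e′) k) (*-congˡ (^-assocʳ x e′ k))

    -- Both `b` and `e′` would be exponents of `x ^ m`, the first because `m * b` is `e`. They are
    -- coprime, so `x ^ m` would be 1.
    repaired : x ^ (e′ ℕ.* m) ≉ 1#
    repaired eq with prime⇒irreducible b-prime (gcd[m,n]∣m b e′)
    ... | inj₂ gcd≡b = b∤e′ (≡.subst (ℕ._∣ e′) gcd≡b (gcd[m,n]∣n b e′))
    ... | inj₁ gcd≡1 = xᵐ≉1 (begin
      x ^ m                ≈⟨ *-identityʳ _ ⟨
      (x ^ m) ^ 1          ≡⟨ ≡.cong ((x ^ m) ^_) gcd≡1 ⟨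
      (x ^ m) ^ gcd b e′   ≈⟨ ^-gcd b e′
                                (trans (^-assocʳ x m b) (trans (^-congʳ x (≡.sym e≡mb)) (exp x x≉0)))
                                (trans (^-assocʳ x m e′) (trans (^-congʳ x (ℕ.*-comm m e′)) eq)) ⟩
      1#                   ∎)

    -- The prime `r` survives in `e′`, which makes `e′ * k` a multiple of `r * k`, that is, of `e`.
    unaffected : ∀ {r k} → Prime r → r ≢ b → e ≡ k ℕ.* r → x ^ (e′ ℕ.* k) ≈ 1#
    unaffected {r} {k} r-prime r≢b e≡kr with keeps r-prime r≢b (ℕ.divides k e≡kr)
    ... | ℕ.divides t ≡.refl = ^-∣ (ℕ.divides t (≡.trans (ℕ.*-assoc t r k)
      (≡.cong (t ℕ.*_) (≡.trans (ℕ.*-comm r k) (≡.sym e≡kr))))) (exp x x≉0)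

    extend : Avoids e (suc b) (g * x ^ e′)
    extend r k r-prime r<1+b eq gxᵏ≈1 with ℕ.m<1+n⇒m<n∨m≡n r<1+b
    ... | inj₁ r<b    = av r k r-prime r<b eq (begin
      g ^ k                     ≈⟨ *-identityʳ _ ⟨
      g ^ k * 1#                ≈⟨ *-congˡ (unaffected {r} {k} r-prime (ℕ.<⇒≢ r<b) eq) ⟨
      g ^ k * x ^ (e′ ℕ.* k)    ≈⟨ expand k ⟨
      (g * x ^ e′) ^ k          ≈⟨ gxᵏ≈1 ⟩
      1#                        ∎)
    ... | inj₂ ≡.refl with ℕ.*-cancelʳ-≡ k m b {{prime⇒nonZero b-prime}} (≡.trans (≡.sym eq) e≡mb)
    ...   | ≡.refl = repaired (begin
      x ^ (e′ ℕ.* m)            ≈⟨ *-identityˡ _ ⟨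
      1# * x ^ (e′ ℕ.* m)       ≈⟨ *-congʳ gᵐ≈1 ⟨
      g ^ m * x ^ (e′ ℕ.* m)    ≈⟨ expand m ⟨
      (g * x ^ e′) ^ m          ≈⟨ gxᵏ≈1 ⟩
      1#                        ∎)

  -- If `g ^ k ≈ 1`, then also `g ^ d ≈ 1` for d = gcd k e, a proper divisor of `e`. A prime `r`
  -- dividing e / d then makes e / r a multiple of d, so `g ^ (e / r) ≈ 1`, which is excluded.
  avoids⇒order : ∀ {e g} → 0 ℕ.< e → g ^ e ≈ 1# → Avoids e (suc e) g → ∀ k → 0 ℕ.< k → k ℕ.< e → g ^ k ≉ 1#
  avoids⇒order {e} {g} 0<e gᵉ≈1 av k 0<k k<e gᵏ≈1 with gcd[m,n]∣n k e
  ... | ℕ.divides t e≡td with primeDivisor t 1<t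
    where
    d = gcd k e
    d<e : d ℕ.< e
    d<e = ℕ.≤-<-trans (ℕ.∣⇒≤ {{ℕ.>-nonZero 0<k}} (gcd[m,n]∣m k e)) k<e
    1<t : 1 ℕ.< t
    1<t = ℕ.*-cancelʳ-< d 1 t (≡.subst₂ ℕ._<_ (≡.sym (ℕ.*-identityˡ d)) e≡td d<e)
  ...   | r , r-prime , ℕ.divides s ≡.refl = av r (s ℕ.* d) r-prime r<1+e e≡sdr (^-∣ (ℕ.n∣m*n s) (^-gcd k e gᵏ≈1 gᵉ≈1))
    where
    d = gcd k e
    e≡sdr : e ≡ s ℕ.* d ℕ.* r
    e≡sdr = ≡.trans e≡td (≡.trans (ℕ.*-assoc s r d)
      (≡.trans (≡.cong (s ℕ.*_) (ℕ.*-comm r d)) (≡.sym (ℕ.*-assoc s d r))))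
    r<1+e : r ℕ.< suc e
    r<1+e = ℕ.s≤s (ℕ.∣⇒≤ {{ℕ.>-nonZero 0<e}} (ℕ.divides (s ℕ.* d) e≡sdr))

-- Cyclicity of the unit group

module CyclicUnits {c ℓ : Level} {n : ℕ} (F : FiniteField c ℓ (suc n)) where
  open FiniteField F hiding (zero)
  open FieldProperties F public
  open import Algebra.Properties.CommutativeSemiring.Exp commutativeSemiring using (_^_)

  unit : Fin n → Carrier
  unit i = element (punchIn (index 0#) i)

  unit≉0 : ∀ i → unit i ≉ 0#
  unit≉0 i eq = Fin.punchInᵢ≢i (index 0#) i (≡.trans (≡.sym (index-element _)) (index-cong eq))

  -- Were e < n, the monic function `x ^ e` would take the value 1 at e + 1 distinct units.
  n≤exponent : ∀ e → 0 ℕ.< e → Exponent e → n ℕ.≤ e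
  n≤exponent (suc d) _ exp = ℕ.≮⇒≥ λ e<n → monic-rootBound d (monic-^ (suc d))
    (λ i → unit (inject≤ i e<n))
    (λ {i} {j} eq → Fin.inject≤-injective e<n e<n i j (Fin.punchIn-injective (index 0#) _ _ (element-injective eq)))
    1# (λ i → exp _ (unit≉0 (inject≤ i e<n)))

  -- The least exponent `e` is the order of a single element, and `e` is at least `n` by the root
  -- count.
  primitiveRoot : ∃ λ g → g ≉ 0# × (∀ k → 0 ℕ.< k → k ℕ.< n → g ^ k ≉ 1#)
  primitiveRoot with leastExponent
  ... | e , least@(0<e , exp , _) with avoids least (suc e)
  ...   | g , g≉0 , av = g , g≉0 , λ k 0<k k<n →
    avoids⇒order 0<e (exp g g≉0) av k 0<k (ℕ.<-≤-trans k<n (n≤exponent e 0<e exp))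

  module PrimitiveRoot (g : Carrier) (g≉0 : g ≉ 0#) (order : ∀ k → 0 ℕ.< k → k ℕ.< n → g ^ k ≉ 1#) where

    ^-injective : ∀ {i j} → i ℕ.< n → j ℕ.< n → g ^ i ≈ g ^ j → i ≡ j
    ^-injective {i} {j} i<n j<n eq with ℕ.<-cmp i j
    ... | tri< i<j _ _ = contradiction (^-cancel g≉0 (ℕ.<⇒≤ i<j) eq)
                           (order (j ℕ.∸ i) (ℕ.m<n⇒0<n∸m i<j) (ℕ.≤-<-trans (ℕ.m∸n≤m j i) j<n))
    ... | tri≈ _ i≡j _ = i≡j
    ... | tri> _ _ j<i = contradiction (^-cancel g≉0 (ℕ.<⇒≤ j<i) (sym eq))
                           (order (i ℕ.∸ j) (ℕ.m<n⇒0<n∸m j<i) (ℕ.≤-<-trans (ℕ.m∸n≤m i j) i<n))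

    power : Fin n → Carrier
    power i = g ^ toℕ i

    power-injective : ∀ {i j} → power i ≈ power j → i ≡ j
    power-injective {i} {j} eq = Fin.toℕ-injective (^-injective (Fin.toℕ<n i) (Fin.toℕ<n j) eq)

    power≉0 : ∀ i → power i ≉ 0#
    power≉0 i = ^-≉0 g≉0 (toℕ i)

    -- Otherwise 0, `a` and the `n` powers of `g` would be n + 2 distinct elements of a field with n
    -- + 1.
    power-surjective : ∀ a → a ≉ 0# → ∃ λ i → power i ≈ a
    power-surjective a a≉0 = decidable-stable (Fin.any? λ i → power i ≟ a) λ a∉powers →
      Fin.<⇒notInjective {f = f} (ℕ.n<1+n (suc n)) (f-injective a∉powers _ _)
      where
      f : Fin (suc (suc n)) → Fin (suc n)
      f zero          = index 0#
      f (suc zero)    = index a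
      f (suc (suc i)) = index (power i)
      f-injective : ¬ (∃ λ i → power i ≈ a) → ∀ i j → f i ≡ f j → i ≡ j
      f-injective a∉ zero          zero          _  = ≡.refl
      f-injective a∉ zero          (suc zero)    eq = contradiction (sym (index-injective eq)) a≉0
      f-injective a∉ zero          (suc (suc j)) eq = contradiction (sym (index-injective eq)) (power≉0 j)
      f-injective a∉ (suc zero)    zero          eq = contradiction (index-injective eq) a≉0
      f-injective a∉ (suc zero)    (suc zero)    _  = ≡.refl
      f-injective a∉ (suc zero)    (suc (suc j)) eq = contradiction (j , sym (index-injective eq)) a∉
      f-injective a∉ (suc (suc i)) zero          eq = contradiction (index-injective eq) (power≉0 i)
      f-injective a∉ (suc (suc i)) (suc zero)    eq = contradiction (i , index-injective eq) a∉
      f-injective a∉ (suc (suc i)) (suc (suc j)) eq =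
        ≡.cong (λ k → suc (suc k)) (power-injective {i} {j} (index-injective eq))

-- The action of GA(1,q) on the field

module AffineAction {c ℓ : Level} {q : ℕ} (F : FiniteField c ℓ q) where
  open FiniteField F hiding (zero)
  open FieldProperties F
  open Affine
  open import Algebra.Properties.Ring ring using (-‿distribʳ-*)
  open import Algebra.Properties.Group +-group using (∙-cancelˡ; ∙-cancelʳ; ⁻¹-injective)
  open import Relation.Binary.Reasoning.Setoid setoid

  apply : Affine F → Carrier → Carrier
  apply h x = slope h * x + shift h

  apply-cong : ∀ {h k x y} → Group._≈_ (GA₁ F) h k → x ≈ y → apply h x ≈ apply k y
  apply-cong (p , p′) e = +-cong (*-cong p e) p′

  apply-∘ : ∀ w h x → apply (Group._∙_ (GA₁ F) w h) x ≈ apply w (apply h x)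
  apply-∘ (affine a b _) (affine a′ b′ _) x = begin
    a * a′ * x + (a * b′ + b)    ≈⟨ +-assoc _ _ _ ⟨
    a * a′ * x + a * b′ + b      ≈⟨ +-congʳ (+-congʳ (*-assoc a a′ x)) ⟩
    a * (a′ * x) + a * b′ + b    ≈⟨ +-congʳ (distribˡ a _ _) ⟨
    a * (a′ * x + b′) + b        ∎

  apply-injective : ∀ h {x y} → apply h x ≈ apply h y → x ≈ y
  apply-injective h eq = *-cancelˡ (slope≉0 h) (∙-cancelʳ (shift h) _ _ eq)

  apply-surjective : ∀ h y → ∃ λ x → apply h x ≈ y
  apply-surjective h@(affine a b a≉0) y with invertible a≉0
  ... | a⁻¹ , _ , aa⁻¹≈1 = a⁻¹ * (y - b) , (begin
    a * (a⁻¹ * (y - b)) + b  ≈⟨ +-congʳ (*-assoc a a⁻¹ (y - b)) ⟨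
    a * a⁻¹ * (y - b) + b    ≈⟨ +-congʳ (*-congʳ aa⁻¹≈1) ⟩
    1# * (y - b) + b         ≈⟨ +-congʳ (*-identityˡ (y - b)) ⟩
    y - b + b                ≈⟨ +-assoc y (- b) b ⟩
    y + (- b + b)            ≈⟨ +-congˡ (-‿inverseˡ b) ⟩
    y + 0#                   ≈⟨ +-identityʳ y ⟩
    y                        ∎)

  -- Lets the quotient w = k h⁻¹ be used only through the equation w h = k, so that entries of the
  -- group matrix can be evaluated without computing an inverse map.
  quotient-∙ : ∀ k h → Group._≈_ (GA₁ F) (Group._∙_ (GA₁ F) (Group._∙_ (GA₁ F) k (Group._⁻¹ (GA₁ F) h)) h) k
  quotient-∙ k h = G.trans {k G.∙ h G.⁻¹ G.∙ h} {k G.∙ (h G.⁻¹ G.∙ h)} {k} (G.assoc k (h G.⁻¹) h)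
    (G.trans {k G.∙ (h G.⁻¹ G.∙ h)} {k G.∙ G.ε} {k}
      (G.∙-congˡ {k} {h G.⁻¹ G.∙ h} {G.ε} (G.inverseˡ h)) (G.identityʳ k))
    where module G = Group (GA₁ F)

  -- The map x ↦ a (x − r): every affine map is determined by its slope a and its root r.
  withRoot : ∀ a → a ≉ 0# → Carrier → Affine F
  withRoot a a≉0 r = affine a (- (a * r)) a≉0

  apply-withRoot : ∀ a {a≉0} r x → apply (withRoot a a≉0 r) x ≈ a * (x - r)
  apply-withRoot a r x = begin
    a * x + - (a * r)    ≈⟨ +-congˡ (-‿distribʳ-* a r) ⟩
    a * x + a * - r      ≈⟨ distribˡ a x (- r) ⟨
    a * (x - r)          ∎

  apply-root : ∀ a {a≉0} r → apply (withRoot a a≉0 r) r ≈ 0#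
  apply-root a r = -‿inverseʳ (a * r)

  apply≈0⇒root : ∀ a {a≉0} r x → apply (withRoot a a≉0 r) x ≈ 0# → x ≈ r
  apply≈0⇒root a {a≉0} r x eq = apply-injective (withRoot a a≉0 r) (trans eq (sym (apply-root a {a≉0} r)))

  withRoot-injective : ∀ {a b a≉0 b≉0 r s} → Group._≈_ (GA₁ F) (withRoot a a≉0 r) (withRoot b b≉0 s) → r ≈ s
  withRoot-injective {a} {b} {a≉0} {b≉0} {r} {s} (a≈b , ar≈bs) = *-cancelˡ a≉0 (begin
    a * r  ≈⟨ ⁻¹-injective ar≈bs ⟩
    b * s  ≈⟨ *-congʳ a≈b ⟨
    a * s  ∎)

  withRoot-surjective : ∀ h → ∃ λ r → Group._≈_ (GA₁ F) (withRoot (slope h) (slope≉0 h) r) h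
  withRoot-surjective h@(affine a b a≉0) with apply-surjective h 0#
  ... | r , ar+b≈0 = r , refl , ∙-cancelˡ (a * r) _ _ (trans (-‿inverseʳ (a * r)) (sym ar+b≈0))

  module _ {a b a≉0 b≉0 r s w} (eq : Group._≈_ (GA₁ F) (Group._∙_ (GA₁ F) w (withRoot b b≉0 s)) (withRoot a a≉0 r)) where

    -- Following b (x - s) by multiplication with γ keeps the root and multiplies the slope by γ.
    -- This makes the matrix of a homothety block diagonal with respect to roots.
    homothety⇒ : ∀ {γ} → slope w ≈ γ → shift w ≈ 0# → r ≈ s × a ≈ γ * b
    homothety⇒ {γ} w≈γ w≈0 = *-cancelˡ a≉0 (⁻¹-injective (begin
        - (a * r)                      ≈⟨ proj₂ eq ⟨
        slope w * - (b * s) + shift w  ≈⟨ +-congˡ w≈0 ⟩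
        slope w * - (b * s) + 0#       ≈⟨ +-identityʳ _ ⟩
        slope w * - (b * s)            ≈⟨ -‿distribʳ-* (slope w) (b * s) ⟨
        - (slope w * (b * s))          ≈⟨ -‿cong (*-assoc (slope w) b s) ⟨
        - (slope w * b * s)            ≈⟨ -‿cong (*-congʳ (proj₁ eq)) ⟩
        - (a * s)                      ∎))
      , trans (sym (proj₁ eq)) (*-congʳ w≈γ)

    homothety⇐ : ∀ {γ} → r ≈ s → a ≈ γ * b → slope w ≈ γ × shift w ≈ 0#
    homothety⇐ {γ} r≈s a≈γb = *-cancelˡ b≉0 (begin
        b * slope w  ≈⟨ *-comm b (slope w) ⟩
        slope w * b  ≈⟨ proj₁ eq ⟩
        a            ≈⟨ a≈γb ⟩
        γ * b        ≈⟨ *-comm γ b ⟩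
        b * γ        ∎)
      , ∙-cancelˡ (slope w * - (b * s)) _ _ (begin
        slope w * - (b * s) + shift w  ≈⟨ proj₂ eq ⟩
        - (a * r)                      ≈⟨ -‿cong (*-congˡ r≈s) ⟩
        - (a * s)                      ≈⟨ -‿cong (*-congʳ (proj₁ eq)) ⟨
        - (slope w * b * s)            ≈⟨ -‿cong (*-assoc (slope w) b s) ⟩
        - (slope w * (b * s))          ≈⟨ -‿distribʳ-* (slope w) (b * s) ⟩
        slope w * - (b * s)            ≈⟨ +-identityʳ _ ⟨
        slope w * - (b * s) + 0#       ∎)

-- Sums and determinants of integer matrices

open import Data.Integer.Base as Int using (ℤ; _+_; _-_; _*_; _^_; -_; 0ℤ; 1ℤ; -1ℤ)
open import Data.Integer.Properties using
  ( +-*-semiring; +-comm; +-assoc; +-identityˡ; +-identityʳ; +-inverseʳ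
  ; *-comm; *-assoc; *-identityˡ; *-identityʳ; *-zeroʳ; pos-* )
open import Data.Integer.Tactic.RingSolver using (solve-∀)
open import Algebra.Properties.Semiring.Sum +-*-semiring
open ≡ hiding ([_])
open ≡-Reasoning

private
  variable
    m m′ n : ℕ

⟦_⟧ : ∀ {a} {A : Set a} → Dec A → ℤ
⟦ d ⟧ = if does d then 1ℤ else 0ℤ

⟦⟧-true : ∀ {a} {A : Set a} (d : Dec A) → A → ⟦ d ⟧ ≡ 1ℤ
⟦⟧-true (yes _) _ = refl
⟦⟧-true (no ¬a) a = contradiction a ¬a

⟦⟧-false : ∀ {a} {A : Set a} (d : Dec A) → ¬ A → ⟦ d ⟧ ≡ 0ℤ
⟦⟧-false (yes a) ¬a = contradiction a ¬a
⟦⟧-false (no _)  _  = refl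

⟦⟧-cong : ∀ {a b} {A : Set a} {B : Set b} (d : Dec A) (e : Dec B) → (A → B) → (B → A) → ⟦ d ⟧ ≡ ⟦ e ⟧
⟦⟧-cong (yes a) e f g = sym (⟦⟧-true e (f a))
⟦⟧-cong (no ¬a) e f g = sym (⟦⟧-false e (¬a ∘ g))

⟦⟧*⟦⟧-cong : ∀ {a b c d} {A : Set a} {B : Set b} {C : Set c} {D : Set d}
             (x : Dec A) (y : Dec B) (z : Dec C) (w : Dec D) →
             (A → B → C × D) → (C → D → A × B) → ⟦ x ⟧ * ⟦ y ⟧ ≡ ⟦ z ⟧ * ⟦ w ⟧
⟦⟧*⟦⟧-cong (yes a) (yes b) z w f g = sym (cong₂ _*_ (⟦⟧-true z (proj₁ (f a b))) (⟦⟧-true w (proj₂ (f a b))))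
⟦⟧*⟦⟧-cong x y (yes c) (yes d) f g = cong₂ _*_ (⟦⟧-true x (proj₁ (g c d))) (⟦⟧-true y (proj₂ (g c d)))
⟦⟧*⟦⟧-cong (yes a) (no ¬b) (yes c) (no ¬d) f g = refl
⟦⟧*⟦⟧-cong (yes a) (no ¬b) (no ¬c) w       f g = refl
⟦⟧*⟦⟧-cong (no ¬a) y       (yes c) (no ¬d) f g = refl
⟦⟧*⟦⟧-cong (no ¬a) y       (no ¬c) w       f g = refl

sum-zero : (f : Vector ℤ n) → (∀ i → f i ≡ 0ℤ) → sum f ≡ 0ℤ
sum-zero {n} f f≗0 = trans (sum-cong-≗ f≗0) (sum-replicate-zero n)

sum-single : ∀ i (f : Vector ℤ n) → (∀ j → j ≢ i → f j ≡ 0ℤ) → sum f ≡ f i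
sum-single {suc n} i f f≡0 = begin
  sum f                      ≡⟨ sum-remove {i = i} f ⟩
  f i + sum (removeAt f i)   ≡⟨ cong (f i +_) (sum-zero _ λ j → f≡0 _ (Fin.punchInᵢ≢i i j)) ⟩
  f i + 0ℤ                   ≡⟨ +-identityʳ (f i) ⟩
  f i                        ∎

δ : Fin n → Fin n → ℤ
δ i j = ⟦ i Fin.≟ j ⟧

δ-refl : (i : Fin n) → δ i i ≡ 1ℤ
δ-refl i = ⟦⟧-true (i Fin.≟ i) refl

δ-sym : (i j : Fin n) → δ i j ≡ δ j i
δ-sym i j = ⟦⟧-cong (i Fin.≟ j) (j Fin.≟ i) sym sym

δ-≢ : {i j : Fin n} → i ≢ j → δ i j ≡ 0ℤ
δ-≢ {i = i} {j} = ⟦⟧-false (i Fin.≟ j)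

sum-δˡ : ∀ i (f : Vector ℤ n) → sum (λ j → δ i j * f j) ≡ f i
sum-δˡ i f = begin
  sum (λ j → δ i j * f j)  ≡⟨ sum-single i _ (λ j j≢i → cong (_* f j) (δ-≢ (j≢i ∘ sym))) ⟩
  δ i i * f i              ≡⟨ cong (_* f i) (δ-refl i) ⟩
  1ℤ * f i                 ≡⟨ *-identityˡ (f i) ⟩
  f i                      ∎

sum-δʳ : ∀ i (f : Vector ℤ n) → sum (λ j → f j * δ j i) ≡ f i
sum-δʳ i f = begin
  sum (λ j → f j * δ j i)  ≡⟨ sum-single i _ (λ j j≢i → trans (cong (f j *_) (δ-≢ j≢i)) (*-zeroʳ (f j))) ⟩
  f i * δ i i              ≡⟨ cong (f i *_) (δ-refl i) ⟩
  f i * 1ℤ                 ≡⟨ *-identityʳ (f i) ⟩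
  f i                      ∎

sum-linear : ∀ s (f g : Vector ℤ n) → sum (λ j → f j + s * g j) ≡ sum f + s * sum g
sum-linear s f g = begin
  sum (λ j → f j + s * g j)      ≡⟨ ∑-distrib-+ f (λ j → s * g j) ⟩
  sum f + sum (λ j → s * g j)    ≡⟨ cong (sum f +_) (*-distribˡ-sum s g) ⟨
  sum f + s * sum g              ∎

sum-unique : ∀ {p} {P : Fin n → Set p} (P? : ∀ i → Dec (P i)) →
             ∀ i → P i → (∀ j → P j → j ≡ i) → sum (λ j → ⟦ P? j ⟧) ≡ 1ℤ
sum-unique P? i pᵢ unique = trans
  (sum-single i (λ j → ⟦ P? j ⟧) (λ j j≢i → ⟦⟧-false (P? j) (j≢i ∘ unique j)))
  (⟦⟧-true (P? i) pᵢ)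

sum-1 : ∀ n (f : Vector ℤ n) → (∀ i → f i ≡ 1ℤ) → sum f ≡ Int.+ n
sum-1 zero    f f≗1 = refl
sum-1 (suc n) f f≗1 = cong₂ _+_ (f≗1 zero) (sum-1 n (tail f) (f≗1 ∘ suc))

sum-linear₂ : ∀ s t (f g : Vector ℤ n) → sum (λ j → s * f j + t * g j) ≡ s * sum f + t * sum g
sum-linear₂ s t f g = trans (sum-linear t (λ j → s * f j) g)
  (cong (_+ t * sum g) (sym (*-distribˡ-sum s f)))

sum-minus : (f h : Vector ℤ n) → sum (λ i → f i - h i) ≡ sum f - sum h
sum-minus f h = begin
  sum (λ i → f i - h i)             ≡⟨ sum-cong-≗ (λ i → identity (f i) (h i)) ⟩
  sum (λ i → f i + -1ℤ * h i)       ≡⟨ sum-linear -1ℤ f h ⟩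
  sum f + -1ℤ * sum h               ≡⟨ identity (sum f) (sum h) ⟨
  sum f - sum h                     ∎
  where
  identity : ∀ x y → x - y ≡ x + -1ℤ * y
  identity = solve-∀

-- Alternating multilinear forms

infix 4 _≋_
_≋_ : Matrix ℤ m n → Matrix ℤ m n → Set
X ≋ Y = ∀ i j → X i j ≡ Y i j

infixl 6 _+⟨_⟩_
_+⟨_⟩_ : Vector ℤ n → ℤ → Vector ℤ n → Vector ℤ n
(x +⟨ s ⟩ y) j = x j + s * y j

-- Matrices are functions and mostly agree only pointwise, so every form has to be known to respect
-- pointwise equality.
Respects : (Matrix ℤ m n → ℤ) → Set
Respects F = ∀ {X Y} → X ≋ Y → F X ≡ F Y

VanishesOnEqualHeads : (Matrix ℤ m n → ℤ) → Set
VanishesOnEqualHeads {suc (suc m)} F = ∀ x X → F (x ∷ x ∷ X) ≡ 0ℤ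
VanishesOnEqualHeads F = ⊤

-- Conditions on the leading rows, and the same again once the first row is fixed. Vanishing is thus
-- asked for adjacent equal rows only; `repeated⇒0` extends it. The one equation with scalar `s`
-- covers additivity and homogeneity.
IsAlternating : (Matrix ℤ m n → ℤ) → Set
IsAlternating {zero} F = ⊤
IsAlternating {suc m} F =
  (∀ s x y X → F ((x +⟨ s ⟩ y) ∷ X) ≡ F (x ∷ X) + s * F (y ∷ X)) ×
  VanishesOnEqualHeads F ×
  (∀ x → IsAlternating (F ∘ (x ∷_)))

∷-cong : {x y : Vector ℤ n} {X Y : Matrix ℤ m n} → (∀ j → x j ≡ y j) → X ≋ Y → (x ∷ X) ≋ (y ∷ Y)
∷-cong x≗y X≋Y zero    = x≗y
∷-cong x≗y X≋Y (suc i) = X≋Y i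

≋-refl : {X : Matrix ℤ m n} → X ≋ X
≋-refl i j = refl

head∷tail : (X : Matrix ℤ (suc m) n) → X ≋ (head X ∷ tail X)
head∷tail X zero    j = refl
head∷tail X (suc i) j = refl

Respects-∷ : {F : Matrix ℤ (suc m) n → ℤ} → Respects F → ∀ x → Respects (F ∘ (x ∷_))
Respects-∷ resp x X≋Y = resp (∷-cong (λ _ → refl) X≋Y)

module _ {F : Matrix ℤ (suc (suc m)) n → ℤ} (alt : IsAlternating F) where

  -- Expand the vanishing value of `F` at two leading rows both equal to x + y.
  swap : ∀ x y X → F (x ∷ y ∷ X) ≡ - F (y ∷ x ∷ X)
  swap x y X = begin
    F (x ∷ y ∷ X)
      ≡⟨ identity₁ (F (x ∷ x ∷ X)) (F (x ∷ y ∷ X)) (F (y ∷ x ∷ X)) (F (y ∷ y ∷ X)) ⟩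
    ((F (x ∷ x ∷ X) + 1ℤ * F (x ∷ y ∷ X)) + 1ℤ * (F (y ∷ x ∷ X) + 1ℤ * F (y ∷ y ∷ X)))
      - F (x ∷ x ∷ X) - F (y ∷ y ∷ X) - F (y ∷ x ∷ X)
      ≡⟨ cong (λ u → u - F (x ∷ x ∷ X) - F (y ∷ y ∷ X) - F (y ∷ x ∷ X)) (begin
        (F (x ∷ x ∷ X) + 1ℤ * F (x ∷ y ∷ X)) + 1ℤ * (F (y ∷ x ∷ X) + 1ℤ * F (y ∷ y ∷ X))
          ≡⟨ cong₂ (λ u v → u + 1ℤ * v) (linear₁ x) (linear₁ y) ⟨
        F (x ∷ s ∷ X) + 1ℤ * F (y ∷ s ∷ X)
          ≡⟨ proj₁ alt 1ℤ x y (s ∷ X) ⟨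
        F (s ∷ s ∷ X)
          ≡⟨ vanish s X ⟩
        0ℤ ∎) ⟩
    0ℤ - F (x ∷ x ∷ X) - F (y ∷ y ∷ X) - F (y ∷ x ∷ X)
      ≡⟨ cong₂ (λ u v → 0ℤ - u - v - F (y ∷ x ∷ X)) (vanish x X) (vanish y X) ⟩
    0ℤ - 0ℤ - 0ℤ - F (y ∷ x ∷ X)
      ≡⟨ +-identityˡ _ ⟩
    - F (y ∷ x ∷ X) ∎
    where
    s = x +⟨ 1ℤ ⟩ y
    vanish = proj₁ (proj₂ alt)
    linear₁ : ∀ z → F (z ∷ s ∷ X) ≡ F (z ∷ x ∷ X) + 1ℤ * F (z ∷ y ∷ X)
    linear₁ z = proj₁ (proj₂ (proj₂ alt) z) 1ℤ x y X
    identity₁ : ∀ a b c d → b ≡ ((a + 1ℤ * b) + 1ℤ * (c + 1ℤ * d)) - a - d - c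
    identity₁ = solve-∀

-- Swapping the first two rows carries `x` down one place at a time until it stands next to its
-- copy.
repeated⇒0 : {F : Matrix ℤ (suc m) n → ℤ} → Respects F → IsAlternating F →
             ∀ x X i → (∀ j → X i j ≡ x j) → F (x ∷ X) ≡ 0ℤ
repeated⇒0 {F = F} resp alt x X zero Xᵢ≗x = begin
  F (x ∷ X)           ≡⟨ resp (∷-cong (λ _ → refl) (λ { zero j → Xᵢ≗x j ; (suc i) j → refl })) ⟩
  F (x ∷ x ∷ tail X)  ≡⟨ proj₁ (proj₂ alt) x (tail X) ⟩
  0ℤ                  ∎
repeated⇒0 {F = F} resp alt x X (suc i) Xᵢ≗x = begin
  F (x ∷ X)                  ≡⟨ resp (∷-cong (λ _ → refl) (head∷tail X)) ⟩
  F (x ∷ head X ∷ tail X)    ≡⟨ swap {F = F} alt x (head X) (tail X) ⟩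
  - F (head X ∷ x ∷ tail X)  ≡⟨ cong -_ (repeated⇒0 (Respects-∷ resp (head X)) (proj₂ (proj₂ alt) (head X))
                                          x (tail X) i Xᵢ≗x) ⟩
  0ℤ                         ∎

private
  -- The intended `F` has `x` as a fixed earlier row and so vanishes whenever a row equals `x`. With
  -- this as the hypothesis `vanish`, the induction can fix the head row and pass to a smaller form.
  clear′ : {F : Matrix ℤ m n → ℤ} → Respects F → IsAlternating F → ∀ x →
           (∀ X i → (∀ j → X i j ≡ x j) → F X ≡ 0ℤ) →
           ∀ (c : Vector ℤ m) X → F (λ i → X i +⟨ c i ⟩ x) ≡ F X
  clear′ {zero} resp alt x vanish c X = resp λ ()
  clear′ {suc m} {F = F} resp alt x vanish c X = begin
    F (λ i → X i +⟨ c i ⟩ x)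
      ≡⟨ resp (head∷tail _) ⟩
    F (x₀ ∷ λ i → X (suc i) +⟨ c (suc i) ⟩ x)
      ≡⟨ clear′ (Respects-∷ resp x₀) (proj₂ (proj₂ alt) x₀) x
           (λ Y i Yᵢ≗x → vanish (x₀ ∷ Y) (suc i) Yᵢ≗x) (tail c) (tail X) ⟩
    F (x₀ ∷ tail X)
      ≡⟨ proj₁ alt (head c) (head X) x (tail X) ⟩
    F (head X ∷ tail X) + head c * F (x ∷ tail X)
      ≡⟨ cong₂ (λ u v → u + head c * v) (resp (λ i j → sym (head∷tail X i j)))
           (vanish (x ∷ tail X) zero (λ _ → refl)) ⟩
    F X + head c * 0ℤ
      ≡⟨ cong (F X +_) (*-zeroʳ (head c)) ⟩
    F X + 0ℤ
      ≡⟨ +-identityʳ (F X) ⟩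
    F X ∎
    where x₀ = head X +⟨ head c ⟩ x

clear : {F : Matrix ℤ (suc m) n → ℤ} → Respects F → IsAlternating F →
        ∀ x X (c : Vector ℤ m) → F (x ∷ λ i → X i +⟨ c i ⟩ x) ≡ F (x ∷ X)
clear resp alt x X c =
  clear′ (Respects-∷ resp x) (proj₂ (proj₂ alt) x) x (repeated⇒0 resp alt x) c X

-- The row passes the `k` rows above it by adjacent swaps; the sign is that of the Laplace
-- expansion.
moveToFront : {F : Matrix ℤ (suc m) n → ℤ} → Respects F → IsAlternating F →
              ∀ k X → F (X k ∷ removeAt X k) ≡ -1ℤ ^ toℕ k * F X
moveToFront {F = F} resp alt zero X = begin
  F (head X ∷ tail X)  ≡⟨ resp (λ i j → sym (head∷tail X i j)) ⟩
  F X                  ≡⟨ *-identityˡ (F X) ⟨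
  1ℤ * F X             ∎
moveToFront {suc m} {F = F} resp alt (suc k) X = begin
  F (X (suc k) ∷ removeAt X (suc k))
    ≡⟨ resp (∷-cong (λ _ → refl) (head∷tail _)) ⟩
  F (X (suc k) ∷ head X ∷ removeAt (tail X) k)
    ≡⟨ swap {F = F} alt (X (suc k)) (head X) (removeAt (tail X) k) ⟩
  - F (head X ∷ X (suc k) ∷ removeAt (tail X) k)
    ≡⟨ cong -_ (moveToFront (Respects-∷ resp (head X)) (proj₂ (proj₂ alt) (head X)) k (tail X)) ⟩
  - (-1ℤ ^ toℕ k * F (head X ∷ tail X))
    ≡⟨ cong (λ u → - (-1ℤ ^ toℕ k * u)) (resp (λ i j → sym (head∷tail X i j))) ⟩
  - (-1ℤ ^ toℕ k * F X)
    ≡⟨ identity (-1ℤ ^ toℕ k) (F X) ⟩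
  -1ℤ * -1ℤ ^ toℕ k * F X ∎
  where
  identity : ∀ a b → - (a * b) ≡ -1ℤ * a * b
  identity = solve-∀

record IsLinear (φ : Vector ℤ m → Vector ℤ n) : Set where
  field
    φ-cong   : ∀ {x y} → (∀ j → x j ≡ y j) → ∀ j → φ x j ≡ φ y j
    φ-linear : ∀ s x y j → φ (x +⟨ s ⟩ y) j ≡ (φ x +⟨ s ⟩ φ y) j

private
  map-∷ : ∀ (φ : Vector ℤ m → Vector ℤ m′) x (X : Matrix ℤ n m) →
          (λ i → φ ((x ∷ X) i)) ≋ (φ x ∷ λ i → φ (X i))
  map-∷ φ x X zero    j = refl
  map-∷ φ x X (suc i) j = refl

Respects-∘ : {F : Matrix ℤ n m′ → ℤ} {φ : Vector ℤ m → Vector ℤ m′} →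
             IsLinear φ → Respects F → Respects (F ∘ (φ ∘_))
Respects-∘ lin resp X≋Y = resp (λ i → IsLinear.φ-cong lin (X≋Y i))

-- Used in `IsAlternating-∘`, where mapping over `x ∷ X` and prepending the image of `x` agree only
-- pointwise.
IsAlternating-≗ : {F G : Matrix ℤ n m → ℤ} → (∀ X → F X ≡ G X) → IsAlternating F → IsAlternating G
IsAlternating-≗ {zero} F≗G alt = tt
IsAlternating-≗ {suc n} {F = F} {G} F≗G (linear , vanish , alt) =
    (λ s x y X → trans (sym (F≗G _)) (trans (linear s x y X) (cong₂ (λ u v → u + s * v) (F≗G _) (F≗G _))))
  , vanish′ n F≗G vanish
  , λ x → IsAlternating-≗ (F≗G ∘ (x ∷_)) (alt x)
  where
  -- `n` is taken afresh because `VanishesOnEqualHeads` reduces only once it is known whether a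
  -- second row exists.
  vanish′ : ∀ n {F G : Matrix ℤ (suc n) m → ℤ} → (∀ X → F X ≡ G X) →
            VanishesOnEqualHeads F → VanishesOnEqualHeads G
  vanish′ zero    _   _      = tt
  vanish′ (suc n) F≗G vanish x X = trans (sym (F≗G _)) (vanish x X)

IsAlternating-∘ : {F : Matrix ℤ n m′ → ℤ} {φ : Vector ℤ m → Vector ℤ m′} → IsLinear φ →
                  Respects F → IsAlternating F → IsAlternating (F ∘ (φ ∘_))
IsAlternating-∘ {zero} lin resp alt = tt
IsAlternating-∘ {suc n} {F = F} {φ} lin resp (linear , vanish , alt) =
    (λ s x y X → begin
      F (φ ∘ ((x +⟨ s ⟩ y) ∷ X))
        ≡⟨ resp (λ { zero j → φ-linear s x y j ; (suc i) j → refl }) ⟩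
      F ((φ x +⟨ s ⟩ φ y) ∷ (φ ∘ X))
        ≡⟨ linear s (φ x) (φ y) (φ ∘ X) ⟩
      F (φ x ∷ (φ ∘ X)) + s * F (φ y ∷ (φ ∘ X))
        ≡⟨ cong₂ (λ u v → u + s * v) (resp (map-∷ φ x X)) (resp (map-∷ φ y X)) ⟨
      F (φ ∘ (x ∷ X)) + s * F (φ ∘ (y ∷ X)) ∎)
  , vanish′ n resp vanish
  , λ x → IsAlternating-≗ (λ X → resp (λ i j → sym (map-∷ φ x X i j)))
            (IsAlternating-∘ lin (Respects-∷ resp (φ x)) (alt (φ x)))
  where
  open IsLinear lin
  vanish′ : ∀ n {F : Matrix ℤ (suc n) _ → ℤ} → Respects F →
            VanishesOnEqualHeads F → VanishesOnEqualHeads (F ∘ (φ ∘_))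
  vanish′ zero    resp vanish = tt
  vanish′ (suc n) resp vanish x X =
    trans (resp (λ { zero j → refl ; (suc zero) j → refl ; (suc (suc i)) j → refl })) (vanish (φ x) (φ ∘ X))

IsAlternating-sum : ∀ {k} (c : Vector ℤ k) (F : Fin k → Matrix ℤ n m → ℤ) →
                    (∀ j → IsAlternating (F j)) → IsAlternating (λ X → sum λ j → c j * F j X)
IsAlternating-sum {zero} c F alt = tt
IsAlternating-sum {suc n} c F alt =
    (λ s x y X → begin
      sum (λ j → c j * F j ((x +⟨ s ⟩ y) ∷ X))
        ≡⟨ sum-cong-≗ (λ j → trans (cong (c j *_) (proj₁ (alt j) s x y X)) (identity (c j) s _ _)) ⟩
      sum (λ j → c j * F j (x ∷ X) + s * (c j * F j (y ∷ X)))
        ≡⟨ sum-linear s (λ j → c j * F j (x ∷ X)) (λ j → c j * F j (y ∷ X)) ⟩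
      sum (λ j → c j * F j (x ∷ X)) + s * sum (λ j → c j * F j (y ∷ X)) ∎)
  , vanish n F (proj₁ ∘ proj₂ ∘ alt)
  , λ x → IsAlternating-sum c (λ j X → F j (x ∷ X)) (λ j → proj₂ (proj₂ (alt j)) x)
  where
  identity : ∀ c s a b → c * (a + s * b) ≡ c * a + s * (c * b)
  identity = solve-∀
  vanish : ∀ n (F : Fin _ → Matrix ℤ (suc n) _ → ℤ) → (∀ j → VanishesOnEqualHeads (F j)) →
           VanishesOnEqualHeads (λ X → sum λ j → c j * F j X)
  vanish zero    F v     = tt
  vanish (suc n) F v x X = sum-zero _ (λ j → trans (cong (c j *_) (v j x X)) (*-zeroʳ (c j)))

-- Determinants

det-cong : {X Y : Matrix ℤ n n} → X ≋ Y → det X ≡ det Y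
det-cong {zero} X≋Y = refl
det-cong {suc n} X≋Y = sum-cong-≗ λ j →
  cong₂ (λ u v → -1ℤ ^ toℕ j * u * v) (X≋Y zero j) (det-cong λ i k → X≋Y (suc i) (punchIn j k))

-- Expand along the first row and then the first column, or the reverse. Apart from the corner term,
-- both orders give the same double sum over one entry of the first row, one of the first column and
-- the minor avoiding both.
det-ᵀ : (X : Matrix ℤ n n) → det (flip X) ≡ det X
det-ᵀ {zero} X = refl
det-ᵀ {suc zero} X = refl
det-ᵀ {suc (suc n)} X = cong₂ _+_
  (cong (1ℤ * X zero zero *_) (det-ᵀ {suc n} λ i j → X (suc i) (suc j)))
  (begin
    sum (λ j → sgn (suc j) * X (suc j) zero * det (λ a b → X (punchIn (suc j) b) (suc a)))
      ≡⟨ sum-cong-≗ (λ j → trans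
           (cong (sgn (suc j) * X (suc j) zero *_) (det-ᵀ {suc n} λ a b → X (punchIn (suc j) a) (suc b)))
           (*-distribˡ-sum (sgn (suc j) * X (suc j) zero) (λ i → sgn i * X zero (suc i) * minor i j))) ⟩
    sum (λ j → sum (λ i → sgn (suc j) * X (suc j) zero * (sgn i * X zero (suc i) * minor i j)))
      ≡⟨ ∑-comm (λ j i → sgn (suc j) * X (suc j) zero * (sgn i * X zero (suc i) * minor i j)) ⟩
    sum (λ i → sum (λ j → sgn (suc j) * X (suc j) zero * (sgn i * X zero (suc i) * minor i j)))
      ≡⟨ sum-cong-≗ (λ i → sum-cong-≗ (λ j →
           identity (sgn j) (X (suc j) zero) (sgn i) (X zero (suc i)) (minor i j))) ⟩
    sum (λ i → sum (λ j → sgn (suc i) * X zero (suc i) * (sgn j * X (suc j) zero * minor i j)))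
      ≡⟨ sum-cong-≗ (λ i → trans
           (sym (*-distribˡ-sum (sgn (suc i) * X zero (suc i)) (λ j → sgn j * X (suc j) zero * minor i j)))
           (cong (sgn (suc i) * X zero (suc i) *_)
             (trans (sum-cong-≗ λ j → cong (sgn j * X (suc j) zero *_) (sym (det-ᵀ (minorMatrix i j))))
                    (det-ᵀ {suc n} λ a b → X (suc a) (punchIn (suc i) b))))) ⟩
    sum (λ i → sgn (suc i) * X zero (suc i) * det (λ a b → X (suc a) (punchIn (suc i) b))) ∎)
  where
  sgn : Fin m → ℤ
  sgn j = -1ℤ ^ toℕ j
  minorMatrix : Fin (suc n) → Fin (suc n) → Matrix ℤ n n
  minorMatrix i j a b = X (suc (punchIn j a)) (suc (punchIn i b))
  minor : Fin (suc n) → Fin (suc n) → ℤ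
  minor i j = det (minorMatrix i j)
  identity : ∀ s x t y d → -1ℤ * s * x * (t * y * d) ≡ -1ℤ * t * y * (s * x * d)
  identity = solve-∀

-- In the row expansion the first two terms have equal minors and opposite signs; every later minor
-- again starts with two equal columns.
det-equalColumns : (X : Matrix ℤ (suc (suc n)) (suc (suc n))) →
                   (∀ i → X i zero ≡ X i (suc zero)) → det X ≡ 0ℤ
det-equalColumns {n} X eq = begin
  t zero + (t (suc zero) + sum (λ j → t (suc (suc j))))
    ≡⟨ cong₂ (λ u v → u + (t (suc zero) + v)) t₀≡ (sum-zero _ (rest n X eq)) ⟩
  1ℤ * X zero (suc zero) * D + (-1ℤ * 1ℤ * X zero (suc zero) * D + 0ℤ)
    ≡⟨ identity (X zero (suc zero)) D ⟩
  0ℤ ∎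
  where
  t : Fin (suc (suc n)) → ℤ
  t j = -1ℤ ^ toℕ j * X zero j * det (λ i → removeAt (X (suc i)) j)
  D = det (λ i → removeAt (X (suc i)) (suc zero))
  t₀≡ : t zero ≡ 1ℤ * X zero (suc zero) * D
  t₀≡ = cong₂ (λ u v → 1ℤ * u * v) (eq zero)
          (det-cong {X = λ i → removeAt (X (suc i)) zero} {Y = λ i → removeAt (X (suc i)) (suc zero)}
            λ { i zero → sym (eq (suc i)) ; i (suc j) → refl })
  identity : ∀ x d → 1ℤ * x * d + (-1ℤ * 1ℤ * x * d + 0ℤ) ≡ 0ℤ
  identity = solve-∀
  rest : ∀ n (X : Matrix ℤ (suc (suc n)) (suc (suc n))) → (∀ i → X i zero ≡ X i (suc zero)) →
         ∀ (j : Fin n) → -1ℤ ^ toℕ (suc (suc j)) * X zero (suc (suc j)) *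
                         det (λ i → removeAt (X (suc i)) (suc (suc j))) ≡ 0ℤ
  rest (suc n) X eq j = trans
    (cong (-1ℤ ^ toℕ (suc (suc j)) * X zero (suc (suc j)) *_)
      (det-equalColumns (λ i → removeAt (X (suc i)) (suc (suc j))) (λ i → eq (suc i))))
    (*-zeroʳ (-1ℤ ^ toℕ (suc (suc j)) * X zero (suc (suc j))))

-- Expansion along the first row shows everything except vanishing on two equal leading rows, which
-- is moved to columns by `det-ᵀ`.
det-isAlternating : ∀ n → IsAlternating (det {n})
det-isAlternating zero    = tt
det-isAlternating (suc n) =
    (λ s x y X → begin
      sum (λ j → sgn j * (x j + s * y j) * minor X j)
        ≡⟨ sum-cong-≗ (λ j → identity (sgn j) (x j) s (y j) (minor X j)) ⟩
      sum (λ j → sgn j * x j * minor X j + s * (sgn j * y j * minor X j))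
        ≡⟨ sum-linear s (λ j → sgn j * x j * minor X j) (λ j → sgn j * y j * minor X j) ⟩
      sum (λ j → sgn j * x j * minor X j) + s * sum (λ j → sgn j * y j * minor X j) ∎)
  , vanish n
  , λ x → IsAlternating-sum (λ j → sgn j * x j) (λ j X → minor X j) (λ j →
      IsAlternating-∘ (record { φ-cong = λ e k → e (punchIn j k) ; φ-linear = λ _ _ _ _ → refl })
        det-cong (det-isAlternating n))
  where
  sgn : Fin (suc n) → ℤ
  sgn j = -1ℤ ^ toℕ j
  minor : Matrix ℤ n (suc n) → Fin (suc n) → ℤ
  minor X j = det (λ i → removeAt (X i) j)
  identity : ∀ a x s y d → a * (x + s * y) * d ≡ a * x * d + s * (a * y * d)
  identity = solve-∀
  vanish : ∀ n → VanishesOnEqualHeads (det {suc n})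
  vanish zero    = tt
  vanish (suc n) x X = trans (sym (det-ᵀ (x ∷ x ∷ X)))
    (det-equalColumns (flip (x ∷ x ∷ X)) (λ _ → refl))

linear-sum : {F : Matrix ℤ (suc m) n → ℤ} → Respects F → IsAlternating F →
             ∀ {k} (c : Vector ℤ k) (e : Matrix ℤ k n) X →
             F ((λ j → sum λ i → c i * e i j) ∷ X) ≡ sum λ i → c i * F (e i ∷ X)
-- The zero row is 0 + (-1) · 0, so linearity makes the value of `F` cancel itself.
linear-sum {F = F} resp alt {zero} c e X = begin
  F (z ∷ X)                    ≡⟨ resp (∷-cong (λ _ → refl) (λ _ _ → refl)) ⟩
  F ((z +⟨ -1ℤ ⟩ z) ∷ X)       ≡⟨ proj₁ alt -1ℤ z z X ⟩
  F (z ∷ X) + -1ℤ * F (z ∷ X)  ≡⟨ identity (F (z ∷ X)) ⟩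
  0ℤ                           ∎
  where
  z : Vector ℤ _
  z _ = 0ℤ
  identity : ∀ a → a + -1ℤ * a ≡ 0ℤ
  identity = solve-∀
linear-sum {F = F} resp alt {suc k} c e X = begin
  F ((λ j → c zero * e zero j + r j) ∷ X)
    ≡⟨ resp (∷-cong (λ j → +-comm (c zero * e zero j) (r j)) ≋-refl) ⟩
  F ((r +⟨ c zero ⟩ e zero) ∷ X)
    ≡⟨ proj₁ alt (c zero) r (e zero) X ⟩
  F (r ∷ X) + c zero * F (e zero ∷ X)
    ≡⟨ +-comm (F (r ∷ X)) _ ⟩
  c zero * F (e zero ∷ X) + F (r ∷ X)
    ≡⟨ cong (c zero * F (e zero ∷ X) +_) (linear-sum resp alt (tail c) (tail e) X) ⟩
  c zero * F (e zero ∷ X) + sum (λ i → c (suc i) * F (e (suc i) ∷ X)) ∎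
  where
  r : Vector ℤ _
  r j = sum λ i → c (suc i) * e (suc i) j

data PunchInView (k : Fin (suc n)) : Fin (suc n) → Set where
  here  : PunchInView k k
  there : ∀ j → PunchInView k (punchIn k j)

punchInView : (k j : Fin (suc n)) → PunchInView k j
punchInView k j with k Fin.≟ j
... | yes refl = here
... | no k≢j   = subst (PunchInView k) (Fin.punchIn-punchOut k≢j) (there _)

-- Expand the first row in the standard basis. Below a first row `δ k`, column `k` can be cleared,
-- so the other rows come from shorter vectors by inserting a 0 at `k`. Induction applies to the
-- form in these shorter rows; its value at the identity is `F δ` up to the sign of moving row `k`
-- to the front.
det-unique : (F : Matrix ℤ n n → ℤ) → Respects F → IsAlternating F → ∀ X → F X ≡ F δ * det X
det-unique {zero} F resp alt X = trans (resp λ ()) (sym (*-identityʳ (F δ)))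
det-unique {suc n} F resp alt X = begin
  F X
    ≡⟨ resp (λ { zero j → sym (sum-δʳ j (X zero)) ; (suc i) j → refl }) ⟩
  F ((λ j → sum λ k → X zero k * δ k j) ∷ tail X)
    ≡⟨ linear-sum resp alt (X zero) δ (tail X) ⟩
  sum (λ k → X zero k * F (δ k ∷ tail X))
    ≡⟨ sum-cong-≗ (λ k → cong (X zero k *_) (expand k)) ⟩
  sum (λ k → X zero k * (-1ℤ ^ toℕ k * F δ * minor k))
    ≡⟨ sum-cong-≗ (λ k → identity (X zero k) (-1ℤ ^ toℕ k) (F δ) (minor k)) ⟩
  sum (λ k → F δ * (-1ℤ ^ toℕ k * X zero k * minor k))
    ≡⟨ *-distribˡ-sum (F δ) (λ k → -1ℤ ^ toℕ k * X zero k * minor k) ⟨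
  F δ * det X ∎
  where
  minor : Fin (suc n) → ℤ
  minor k = det (λ i → removeAt (X (suc i)) k)
  identity : ∀ x s f d → x * (s * f * d) ≡ f * (s * x * d)
  identity = solve-∀
  φ : Fin (suc n) → Vector ℤ n → Vector ℤ (suc n)
  φ k x = insertAt x k 0ℤ
  φ-isLinear : ∀ k → IsLinear (φ k)
  φ-isLinear k = record { φ-cong = φ-cong ; φ-linear = φ-linear }
    where
    φ-cong : ∀ {x y} → (∀ j → x j ≡ y j) → ∀ j → φ k x j ≡ φ k y j
    φ-cong {x} {y} x≗y j with punchInView k j
    ... | here    = trans (insertAt-lookup x k 0ℤ) (sym (insertAt-lookup y k 0ℤ))
    ... | there j = trans (insertAt-punchIn x k 0ℤ j)
                      (trans (x≗y j) (sym (insertAt-punchIn y k 0ℤ j)))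
    φ-linear : ∀ s x y j → φ k (x +⟨ s ⟩ y) j ≡ (φ k x +⟨ s ⟩ φ k y) j
    φ-linear s x y j with punchInView k j
    ... | here    = begin
      φ k (x +⟨ s ⟩ y) k     ≡⟨ insertAt-lookup (x +⟨ s ⟩ y) k 0ℤ ⟩
      0ℤ                     ≡⟨ *-zeroʳ s ⟨
      s * 0ℤ                 ≡⟨ +-identityˡ (s * 0ℤ) ⟨
      0ℤ + s * 0ℤ            ≡⟨ cong₂ (λ u v → u + s * v) (insertAt-lookup x k 0ℤ) (insertAt-lookup y k 0ℤ) ⟨
      φ k x k + s * φ k y k  ∎
    ... | there j = trans (insertAt-punchIn (x +⟨ s ⟩ y) k 0ℤ j)
      (sym (cong₂ (λ u v → u + s * v) (insertAt-punchIn x k 0ℤ j) (insertAt-punchIn y k 0ℤ j)))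
  clearColumn : ∀ k → (λ i → X (suc i) +⟨ - X (suc i) k ⟩ δ k) ≋ (λ i → φ k (removeAt (X (suc i)) k))
  clearColumn k i j with punchInView k j
  ... | here = begin
    X (suc i) k + - X (suc i) k * δ k k  ≡⟨ cong (λ u → X (suc i) k + - X (suc i) k * u) (δ-refl k) ⟩
    X (suc i) k + - X (suc i) k * 1ℤ     ≡⟨ cong (X (suc i) k +_) (*-identityʳ (- X (suc i) k)) ⟩
    X (suc i) k - X (suc i) k            ≡⟨ +-inverseʳ (X (suc i) k) ⟩
    0ℤ                                   ≡⟨ insertAt-lookup (removeAt (X (suc i)) k) k 0ℤ ⟨
    φ k (removeAt (X (suc i)) k) k       ∎
  ... | there j = begin
    x + - X (suc i) k * δ k (punchIn k j)       ≡⟨ cong (λ u → x + - X (suc i) k * u) (δ-≢ (Fin.punchInᵢ≢i k j ∘ sym)) ⟩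
    x + - X (suc i) k * 0ℤ                      ≡⟨ cong (x +_) (*-zeroʳ (- X (suc i) k)) ⟩
    x + 0ℤ                                      ≡⟨ +-identityʳ x ⟩
    x                                           ≡⟨ insertAt-punchIn (removeAt (X (suc i)) k) k 0ℤ j ⟨
    φ k (removeAt (X (suc i)) k) (punchIn k j)  ∎
    where x = X (suc i) (punchIn k j)
  φ-δ : ∀ k → (λ i → φ k (δ i)) ≋ removeAt δ k
  φ-δ k i j with punchInView k j
  ... | here = trans (insertAt-lookup (δ i) k 0ℤ) (sym (δ-≢ (Fin.punchInᵢ≢i k i)))
  ... | there j = trans (insertAt-punchIn (δ i) k 0ℤ j) (δ-punchIn (i Fin.≟ j))
    where
    δ-punchIn : Dec (i ≡ j) → δ i j ≡ δ (punchIn k i) (punchIn k j)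
    δ-punchIn (yes refl) = trans (δ-refl i) (sym (δ-refl (punchIn k i)))
    δ-punchIn (no i≢j)   = trans (δ-≢ i≢j) (sym (δ-≢ (i≢j ∘ Fin.punchIn-injective k i j)))
  expand : ∀ k → F (δ k ∷ tail X) ≡ -1ℤ ^ toℕ k * F δ * minor k
  expand k = begin
    F (δ k ∷ tail X)
      ≡⟨ clear resp alt (δ k) (tail X) (λ i → - X (suc i) k) ⟨
    F (δ k ∷ λ i → X (suc i) +⟨ - X (suc i) k ⟩ δ k)
      ≡⟨ resp (∷-cong (λ _ → refl) (clearColumn k)) ⟩
    F (δ k ∷ λ i → φ k (removeAt (X (suc i)) k))
      ≡⟨ det-unique (λ Y → F (δ k ∷ λ i → φ k (Y i)))
           (Respects-∘ (φ-isLinear k) (Respects-∷ resp (δ k)))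
           (IsAlternating-∘ (φ-isLinear k) (Respects-∷ resp (δ k)) (proj₂ (proj₂ alt) (δ k)))
           (λ i → removeAt (X (suc i)) k) ⟩
    F (δ k ∷ λ i → φ k (δ i)) * minor k
      ≡⟨ cong (_* minor k) (trans (resp (∷-cong (λ _ → refl) (φ-δ k))) (moveToFront resp alt k δ)) ⟩
    -1ℤ ^ toℕ k * F δ * minor k ∎

infixl 7 _⊡_
_⊡_ : Matrix ℤ m n → Matrix ℤ n m′ → Matrix ℤ m m′
(X ⊡ Y) i k = sum λ j → X i j * Y j k

-- For fixed `Y`, the map Z ↦ det (Z Y) is alternating with value det Y at the identity.
det-⊡ : (X Y : Matrix ℤ n n) → det (X ⊡ Y) ≡ det X * det Y
det-⊡ {n} X Y = begin
  det (X ⊡ Y)          ≡⟨ det-unique (λ Z → det (Z ⊡ Y)) (Respects-∘ φ-isLinear det-cong)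
                            (IsAlternating-∘ φ-isLinear det-cong (det-isAlternating n)) X ⟩
  det (δ ⊡ Y) * det X  ≡⟨ cong (_* det X) (det-cong λ i k → sum-δˡ i (λ j → Y j k)) ⟩
  det Y * det X        ≡⟨ *-comm (det Y) (det X) ⟩
  det X * det Y        ∎
  where
  identity : ∀ x s y z → (x + s * y) * z ≡ x * z + s * (y * z)
  identity = solve-∀
  φ-isLinear : IsLinear (λ x k → sum λ j → x j * Y j k)
  φ-isLinear = record
    { φ-cong   = λ x≗y k → sum-cong-≗ λ j → cong (_* Y j k) (x≗y j)
    ; φ-linear = λ s x y k → begin
        sum (λ j → (x j + s * y j) * Y j k)
          ≡⟨ sum-cong-≗ (λ j → identity (x j) s (y j) (Y j k)) ⟩
        sum (λ j → x j * Y j k + s * (y j * Y j k))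
          ≡⟨ sum-linear s (λ j → x j * Y j k) (λ j → y j * Y j k) ⟩
        sum (λ j → x j * Y j k) + s * sum (λ j → y j * Y j k) ∎
    }

det-headRow : (X : Matrix ℤ (suc n) (suc n)) → (∀ j → X zero (suc j) ≡ 0ℤ) →
              det X ≡ X zero zero * det (λ i j → X (suc i) (suc j))
det-headRow X x≡0 = begin
  det X                ≡⟨ sum-single zero (λ j → -1ℤ ^ toℕ j * X zero j * minor j) (λ
                            { zero j≢0 → contradiction refl j≢0
                            ; (suc j) _ → trans (cong (λ u → -1ℤ ^ toℕ (suc j) * u * minor (suc j)) (x≡0 j))
                                            (identity (-1ℤ ^ toℕ (suc j)) (minor (suc j))) }) ⟩
  1ℤ * X zero zero * minor zero  ≡⟨ cong (_* minor zero) (*-identityˡ (X zero zero)) ⟩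
  X zero zero * minor zero       ∎
  where
  minor : Fin _ → ℤ
  minor j = det (λ i → removeAt (X (suc i)) j)
  identity : ∀ a b → a * 0ℤ * b ≡ 0ℤ
  identity = solve-∀

det-headColumn : (X : Matrix ℤ (suc n) (suc n)) → (∀ i → X (suc i) zero ≡ 0ℤ) →
                 det X ≡ X zero zero * det (λ i j → X (suc i) (suc j))
det-headColumn X x≡0 = begin
  det X         ≡⟨ det-ᵀ X ⟨
  det (flip X)  ≡⟨ det-headRow (flip X) x≡0 ⟩
  X zero zero * det (λ i j → X (suc j) (suc i))  ≡⟨ cong (X zero zero *_) (det-ᵀ (λ i j → X (suc i) (suc j))) ⟩
  X zero zero * det (λ i j → X (suc i) (suc j))  ∎

det-lowerBlock : ∀ l {n} (X : Matrix ℤ (l ℕ.+ n) (l ℕ.+ n)) →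
                 (∀ (i : Fin l) j → toℕ i ℕ.< toℕ j → X (i ↑ˡ n) j ≡ 0ℤ) →
                 (∀ (i : Fin l) → X (i ↑ˡ n) (i ↑ˡ n) ≡ 1ℤ) →
                 det X ≡ det (λ i j → X (l ↑ʳ i) (l ↑ʳ j))
det-lowerBlock zero    X upper≡0 diag≡1 = refl
det-lowerBlock (suc l) X upper≡0 diag≡1 = begin
  det X                          ≡⟨ det-headRow X (λ j → upper≡0 zero (suc j) ℕ.z<s) ⟩
  X zero zero * det minor        ≡⟨ cong (_* det minor) (diag≡1 zero) ⟩
  1ℤ * det minor                 ≡⟨ *-identityˡ (det minor) ⟩
  det minor                      ≡⟨ det-lowerBlock l minor
                                      (λ i j i<j → upper≡0 (suc i) (suc j) (ℕ.s<s i<j)) (diag≡1 ∘ suc) ⟩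
  det (λ i j → minor (l ↑ʳ i) (l ↑ʳ j)) ∎
  where
  minor : Matrix ℤ _ _
  minor i j = X (suc i) (suc j)

det-scalar : ∀ n d → det {n} (λ i j → d * δ i j) ≡ d ^ n
det-scalar zero    d = refl
det-scalar (suc n) d = begin
  det {suc n} (λ i j → d * δ i j)      ≡⟨ det-headRow {n} (λ i j → d * δ i j) (λ j → *-zeroʳ d) ⟩
  d * 1ℤ * det {n} (λ i j → d * δ i j) ≡⟨ cong₂ _*_ (*-identityʳ d) (det-scalar n d) ⟩
  d * d ^ n                            ∎

-- Split the first row into a constant row and `d` times a basis vector. The constant row clears `c`
-- from all other rows and yields c dⁿ; the basis vector leaves the same kind of matrix one size
-- smaller.
det-constant+scalar : ∀ n c d → det {suc n} (λ i j → c + d * δ i j) ≡ d ^ n * (d + Int.+ suc n * c)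
det-constant+scalar n c d = begin
  det {suc n} (λ i j → c + d * δ i j)
    ≡⟨ det-cong {X = λ i j → c + d * δ i j} {Y = ((λ _ → c) +⟨ d ⟩ δ zero) ∷ Y} (head∷tail _) ⟩
  det (((λ _ → c) +⟨ d ⟩ δ zero) ∷ Y)
    ≡⟨ proj₁ alt d (λ _ → c) (δ zero) Y ⟩
  det ((λ _ → c) ∷ Y) + d * det (δ zero ∷ Y)
    ≡⟨ cong₂ (λ u v → u + d * v) constantRow
         (trans (det-headRow (δ zero ∷ Y) (λ _ → refl)) (*-identityˡ (det (λ i j → Y i (suc j))))) ⟩
  c * d ^ n + d * det {n} (λ i j → c + d * δ i j)
    ≡⟨ conclude n ⟩
  d ^ n * (d + Int.+ suc n * c) ∎
  where
  alt = det-isAlternating (suc n)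
  Y : Matrix ℤ n (suc n)
  Y i j = c + d * δ (suc i) j
  Z : Matrix ℤ n (suc n)
  Z i j = d * δ (suc i) j
  identity₁ : ∀ u c → u + 1ℤ * c ≡ c + u
  identity₁ = solve-∀
  identity₂ : ∀ c d p k → c * (d * p) + d * (p * (d + k * c)) ≡ d * p * (d + (1ℤ + k) * c)
  identity₂ = solve-∀
  identity₃ : ∀ c d → c * 1ℤ + d * 1ℤ ≡ 1ℤ * (d + 1ℤ * c)
  identity₃ = solve-∀
  constantRow : det ((λ _ → c) ∷ Y) ≡ c * d ^ n
  constantRow = begin
    det ((λ _ → c) ∷ Y)
      ≡⟨ det-cong {X = (λ _ → c) ∷ Y} (∷-cong (λ _ → refl) (λ i j → sym (identity₁ (Z i j) c))) ⟩
    det ((λ _ → c) ∷ λ i → Z i +⟨ 1ℤ ⟩ (λ _ → c))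
      ≡⟨ clear det-cong alt (λ _ → c) Z (λ _ → 1ℤ) ⟩
    det ((λ _ → c) ∷ Z)
      ≡⟨ det-headColumn ((λ _ → c) ∷ Z) (λ i → *-zeroʳ d) ⟩
    c * det {n} (λ i j → d * δ i j)
      ≡⟨ cong (c *_) (det-scalar n d) ⟩
    c * d ^ n ∎
  conclude : ∀ n → c * d ^ n + d * det {n} (λ i j → c + d * δ i j) ≡ d ^ n * (d + Int.+ suc n * c)
  conclude zero    = identity₃ c d
  conclude (suc n) = trans (cong (λ u → c * (d * d ^ n) + d * u) (det-constant+scalar n c d))
    (identity₂ c d (d ^ n) (Int.+ suc n))

-- Matrices indexed by pairs

sum-++ : ∀ m {n} (f : Vector ℤ (m ℕ.+ n)) → sum f ≡ sum (λ i → f (i ↑ˡ n)) + sum (λ j → f (m ↑ʳ j))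
sum-++ zero    f = sym (+-identityˡ (sum f))
sum-++ (suc m) f = trans (cong (f zero +_) (sum-++ m (tail f))) (sym (+-assoc (f zero) _ _))

sum-combine : ∀ m {n} (f : Vector ℤ (m ℕ.* n)) → sum f ≡ sum (λ i → sum (λ j → f (combine {m} i j)))
sum-combine zero        f = refl
sum-combine (suc m) {n} f = trans (sum-++ n f)
  (cong (sum (λ j → f (j ↑ˡ m ℕ.* n)) +_) (sum-combine m (λ u → f (n ↑ʳ u))))

module PairIndexed (n q : ℕ) where

  Index : Set
  Index = Fin (suc n) × Fin q

  -- The indices (0 , r) come last.
  encode : Index → Fin (n ℕ.* q ℕ.+ q)
  encode (zero  , r) = n ℕ.* q ↑ʳ r
  encode (suc i , r) = combine i r ↑ˡ q

  decode : Fin (n ℕ.* q ℕ.+ q) → Index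
  decode u = [ map₁ suc ∘ remQuot {n} q , (zero ,_) ]′ (splitAt (n ℕ.* q) u)

  decode-encode : ∀ k → decode (encode k) ≡ k
  decode-encode (zero  , r) rewrite Fin.splitAt-↑ʳ (n ℕ.* q) q r = refl
  decode-encode (suc i , r) rewrite Fin.splitAt-↑ˡ (n ℕ.* q) (combine i r) q =
    cong (map₁ suc) (Fin.remQuot-combine i r)

  encode-decode : ∀ u → encode (decode u) ≡ u
  encode-decode u with splitAt (n ℕ.* q) u in eq
  ... | inj₁ v = trans (cong (_↑ˡ q) (Fin.combine-remQuot {n} q v)) (Fin.splitAt⁻¹-↑ˡ eq)
  ... | inj₂ r = Fin.splitAt⁻¹-↑ʳ eq

  PairMatrix : Set
  PairMatrix = Index → Index → ℤ

  detᴾ : PairMatrix → ℤ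
  detᴾ X = det λ u v → X (decode u) (decode v)

  sumᴾ : (Index → ℤ) → ℤ
  sumᴾ f = sum λ i → sum λ r → f (i , r)

  sumᴾ-cong : ∀ {f g} → (∀ k → f k ≡ g k) → sumᴾ f ≡ sumᴾ g
  sumᴾ-cong f≗g = sum-cong-≗ λ i → sum-cong-≗ λ r → f≗g (i , r)

  sum-decode : ∀ f → sum (λ u → f (decode u)) ≡ sumᴾ f
  sum-decode f = begin
    sum (λ u → f (decode u))
      ≡⟨ sum-++ (n ℕ.* q) (λ u → f (decode u)) ⟩
    sum (λ v → f (decode (v ↑ˡ q))) + sum (λ r → f (decode (n ℕ.* q ↑ʳ r)))
      ≡⟨ cong₂ _+_ (sum-combine n (λ v → f (decode (v ↑ˡ q)))) (sum-cong-≗ λ r → cong f (decode-encode (zero , r))) ⟩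
    sum (λ i → sum λ r → f (decode (combine {n} i r ↑ˡ q))) + sum (λ r → f (zero , r))
      ≡⟨ cong (_+ sum (λ r → f (zero , r)))
           (sum-cong-≗ λ i → sum-cong-≗ λ r → cong f (decode-encode (suc i , r))) ⟩
    sum (λ i → sum λ r → f (suc i , r)) + sum (λ r → f (zero , r))
      ≡⟨ +-comm (sum λ i → sum λ r → f (suc i , r)) _ ⟩
    sumᴾ f ∎

  infixl 7 _⊡ᴾ_
  _⊡ᴾ_ : PairMatrix → PairMatrix → PairMatrix
  (X ⊡ᴾ Y) k h = sumᴾ λ l → X k l * Y l h

  detᴾ-cong : ∀ {X Y} → (∀ k h → X k h ≡ Y k h) → detᴾ X ≡ detᴾ Y
  detᴾ-cong X≗Y = det-cong λ u v → X≗Y (decode u) (decode v)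

  detᴾ-⊡ : ∀ X Y → detᴾ (X ⊡ᴾ Y) ≡ detᴾ X * detᴾ Y
  detᴾ-⊡ X Y = trans
    (det-cong λ u v → sym (sum-decode λ l → X (decode u) l * Y l (decode v)))
    (det-⊡ (λ u v → X (decode u) (decode v)) (λ u v → Y (decode u) (decode v)))

  detᴾ-lowerBlock : ∀ X → (∀ i r h → encode (suc i , r) Fin.< encode h → X (suc i , r) h ≡ 0ℤ) →
                    (∀ i r → X (suc i , r) (suc i , r) ≡ 1ℤ) →
                    detᴾ X ≡ det (λ r s → X (zero , r) (zero , s))
  detᴾ-lowerBlock X upper≡0 diag≡1 = trans
    (det-lowerBlock (n ℕ.* q) (λ u v → X (decode u) (decode v)) upper≡0′ diag≡1′)
    (det-cong λ r s → cong₂ X (decode-encode (zero , r)) (decode-encode (zero , s)))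
    where
    combined : ∀ (P : Fin (n ℕ.* q) → Set) → (∀ i r → P (combine {n} {q} i r)) → ∀ v → P v
    combined P p v = subst P (Fin.combine-remQuot {n} q v) (p (proj₁ (remQuot {n} q v)) (proj₂ (remQuot {n} q v)))
    upper≡0′ : ∀ (v : Fin (n ℕ.* q)) u → toℕ v ℕ.< toℕ u → X (decode (v ↑ˡ q)) (decode u) ≡ 0ℤ
    upper≡0′ = combined _ λ i r u v<u → trans
      (cong (λ k → X k (decode u)) (decode-encode (suc i , r)))
      (upper≡0 i r (decode u) (subst₂ ℕ._<_ (sym (Fin.toℕ-↑ˡ (combine i r) q)) (cong toℕ (sym (encode-decode u))) v<u))
    diag≡1′ : ∀ v → X (decode (v ↑ˡ q)) (decode (v ↑ˡ q)) ≡ 1ℤ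
    diag≡1′ = combined _ λ i r → trans
      (cong₂ X (decode-encode (suc i , r)) (decode-encode (suc i , r))) (diag≡1 i r)

  private
    L : PairMatrix
    L (zero  , r) (j , s) = δ r s
    L (suc i , r) (j , s) = δ (suc i) j * δ r s

    δδ-≢ : ∀ {i j r s} → (i , r) ≢ (j , s) → δ {suc n} i j * δ {q} r s ≡ 0ℤ
    δδ-≢ {i} {j} {r} {s} k≢h with i Fin.≟ j | r Fin.≟ s
    ... | yes refl | yes refl = contradiction refl k≢h
    ... | yes _    | no _     = refl
    ... | no _     | _        = refl

    encode-< : ∀ k h → encode k Fin.< encode h → k ≢ h
    encode-< k h lt refl = Fin.<-irrefl refl lt

    det-δ : ∀ m → det (δ {m}) ≡ 1ℤ
    det-δ zero    = refl
    det-δ (suc m) = trans (det-headRow (δ {suc m}) (λ _ → refl)) (trans (*-identityˡ _) (det-δ m))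

    detᴾ-L : detᴾ L ≡ 1ℤ
    detᴾ-L = trans
      (detᴾ-lowerBlock L (λ i r h lt → δδ-≢ (encode-< (suc i , r) h lt))
        (λ i r → cong₂ _*_ (δ-refl (suc i)) (δ-refl r)))
      (det-δ q)

    sum-δδ : ∀ i r (f : Index → ℤ) → sumᴾ (λ (j , s) → δ i j * δ r s * f (j , s)) ≡ f (i , r)
    sum-δδ i r f = trans
      (sum-cong-≗ λ j → trans (sum-cong-≗ λ s → *-assoc (δ i j) (δ r s) (f (j , s))) (trans
        (sym (*-distribˡ-sum (δ i j) (λ s → δ r s * f (j , s)))) (cong (δ i j *_) (sum-δˡ r (λ s → f (j , s))))))
      (sum-δˡ i (λ j → f (j , r)))

  -- With L adding all rows (i , r) to the row (0 , r), the last rows of L S and the last columns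
  -- of S Lᵀ vanish, so L (S + U K) = X Y₀ where X and Y₀ Lᵀ are block triangular.
  module _ (S : PairMatrix) (U : Index → Fin q → ℤ) (K : Fin q → Index → ℤ)
    (columnSums≡0 : ∀ r h → sum (λ i → S (i , r) h) ≡ 0ℤ)
    (rowSums≡0    : ∀ k s → sum (λ j → S k (j , s)) ≡ 0ℤ)
    (S-diag       : ∀ i r → S (suc i , r) (suc i , r) ≡ 1ℤ)
    (S-upper      : ∀ i j r s → i Fin.< j → S (suc i , r) (suc j , s) ≡ 0ℤ)
    (S-block      : ∀ i r s → r ≢ s → S (suc i , r) (suc i , s) ≡ 0ℤ)
    where

    private
      M X Y₀ : PairMatrix
      M k h = S k h + sum λ z → U k z * K z h

      Û K̂ : Matrix ℤ q q
      Û r z = sum λ i → U (i , r) z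
      K̂ z s = sum λ j → K z (j , s)

      X (zero  , r) (zero  , z) = Û r z
      X (zero  , r) (suc j , s) = 0ℤ
      X (suc i , r) (zero  , z) = U (suc i , r) z
      X (suc i , r) (suc j , s) = δ (suc i) (suc j) * δ r s

      Y₀ (zero  , z) h = K z h
      Y₀ (suc i , r) h = S (suc i , r) h

      L⊡ : ∀ Z r h → (L ⊡ᴾ Z) (zero , r) h ≡ sum λ i → Z (i , r) h
      L⊡ Z r h = sum-cong-≗ λ i → sum-δˡ r (λ s → Z (i , s) h)

      ⊡Lᵀ : ∀ Z k s → (Z ⊡ᴾ flip L) k (zero , s) ≡ sum λ j → Z k (j , s)
      ⊡Lᵀ Z k s = sum-cong-≗ λ j → trans
        (sum-cong-≗ λ t → *-comm (Z k (j , t)) (δ s t)) (sum-δˡ s (λ t → Z k (j , t)))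

      ⊡Lᵀ-suc : ∀ Z k j s → (Z ⊡ᴾ flip L) k (suc j , s) ≡ Z k (suc j , s)
      ⊡Lᵀ-suc Z k j s = trans
        (sumᴾ-cong λ l → *-comm (Z k l) (L (suc j , s) l)) (sum-δδ (suc j) s (Z k))

      -- The rows (0 , r) of L S vanish, so those of L (S + U K) are combinations of the q rows of
      -- K. Hence `Y₀` can store K in the q places where S is no longer required.
      factor : ∀ k h → (L ⊡ᴾ M) k h ≡ (X ⊡ᴾ Y₀) k h
      factor (zero , r) h = begin
        (L ⊡ᴾ M) (zero , r) h
          ≡⟨ L⊡ M r h ⟩
        sum (λ i → S (i , r) h + sum λ z → U (i , r) z * K z h)
          ≡⟨ ∑-distrib-+ (λ i → S (i , r) h) (λ i → sum λ z → U (i , r) z * K z h) ⟩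
        sum (λ i → S (i , r) h) + sum (λ i → sum λ z → U (i , r) z * K z h)
          ≡⟨ cong₂ _+_ (columnSums≡0 r h) (∑-comm λ i z → U (i , r) z * K z h) ⟩
        0ℤ + sum (λ z → sum λ i → U (i , r) z * K z h)
          ≡⟨ +-identityˡ _ ⟩
        sum (λ z → sum λ i → U (i , r) z * K z h)
          ≡⟨ sum-cong-≗ (λ z → *-distribʳ-sum (K z h) (λ i → U (i , r) z)) ⟨
        sum (λ z → Û r z * K z h)
          ≡⟨ +-identityʳ _ ⟨
        sum (λ z → Û r z * K z h) + 0ℤ
          ≡⟨ cong (sum (λ z → Û r z * K z h) +_)
               (sum-zero _ λ i → sum-zero (λ s → 0ℤ * S (suc i , s) h) λ s → refl) ⟨
        (X ⊡ᴾ Y₀) (zero , r) h ∎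
      factor (suc i , r) h = begin
        (L ⊡ᴾ M) (suc i , r) h
          ≡⟨ sum-δδ (suc i) r (λ l → M l h) ⟩
        S (suc i , r) h + sum (λ z → U (suc i , r) z * K z h)
          ≡⟨ +-comm (S (suc i , r) h) _ ⟩
        sum (λ z → U (suc i , r) z * K z h) + S (suc i , r) h
          ≡⟨ cong (sum (λ z → U (suc i , r) z * K z h) +_) (begin
            S (suc i , r) h
              ≡⟨ sum-δδ (suc i) r (λ l → S l h) ⟨
            sum (λ s → 0ℤ * δ r s * S (zero , s) h) + rest
              ≡⟨ cong (_+ rest) (sum-zero (λ s → 0ℤ * δ r s * S (zero , s) h) λ s → refl) ⟩
            0ℤ + rest
              ≡⟨ +-identityˡ rest ⟩
            rest ∎) ⟩
        (X ⊡ᴾ Y₀) (suc i , r) h ∎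
        where
        rest = sum λ j → sum λ s → δ (suc i) (suc j) * δ r s * S (suc j , s) h

      detᴾ-X : detᴾ X ≡ det Û
      detᴾ-X = begin
        -- The indices (0 , r) come last, so `X` has `U` to the right of its identity block;
        -- transposing moves it below the diagonal.
        detᴾ X         ≡⟨ det-ᵀ (λ u v → X (decode u) (decode v)) ⟨
        detᴾ (flip X)  ≡⟨ detᴾ-lowerBlock (flip X) upper (λ i r → cong₂ _*_ (δ-refl (suc i)) (δ-refl r)) ⟩
        det (flip Û)   ≡⟨ det-ᵀ Û ⟩
        det Û          ∎
        where
        upper : ∀ i r h → encode (suc i , r) Fin.< encode h → X h (suc i , r) ≡ 0ℤ
        upper i r (zero  , s) lt = refl
        upper i r (suc j , s) lt = δδ-≢ (encode-< (suc i , r) (suc j , s) lt ∘ sym)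

      -- Multiplication by Lᵀ adds the columns (j , s) to the column (0 , s), which clears the rows
      -- of S there and turns K into `K̂`. The remaining part of S is unitriangular in the order of
      -- `encode`, by first component and then by second.
      detᴾ-Y₀Lᵀ : detᴾ (Y₀ ⊡ᴾ flip L) ≡ det K̂
      detᴾ-Y₀Lᵀ = trans
        (detᴾ-lowerBlock (Y₀ ⊡ᴾ flip L) upper (λ i r → trans (⊡Lᵀ-suc Y₀ (suc i , r) i r) (S-diag i r)))
        (det-cong λ z s → ⊡Lᵀ Y₀ (zero , z) s)
        where
        upper : ∀ i r h → encode (suc i , r) Fin.< encode h → (Y₀ ⊡ᴾ flip L) (suc i , r) h ≡ 0ℤ
        upper i r (zero  , s) lt = trans (⊡Lᵀ Y₀ (suc i , r) s) (rowSums≡0 (suc i , r) s)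
        upper i r (suc j , s) lt = trans (⊡Lᵀ-suc Y₀ (suc i , r) j s) (S≡0 (Fin.<-cmp i j) (r Fin.≟ s))
          where
          S≡0 : _ → Dec (r ≡ s) → S (suc i , r) (suc j , s) ≡ 0ℤ
          S≡0 (tri< i<j _ _)  _          = S-upper i j r s i<j
          S≡0 (tri≈ _ refl _) (yes refl) = contradiction lt (Fin.<-irrefl refl)
          S≡0 (tri≈ _ refl _) (no r≢s)   = S-block i r s r≢s
          S≡0 (tri> _ _ j<i)  _          = contradiction
            (subst₂ ℕ._<_ (sym (Fin.toℕ-↑ˡ (combine j s) q))
              (sym (Fin.toℕ-↑ˡ (combine i r) q)) (Fin.combine-monoˡ-< s r j<i))
            (ℕ.<-asym lt)

    detᴾ-reduce : detᴾ M ≡ det Û * det K̂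
    detᴾ-reduce = begin
      detᴾ M                          ≡⟨ *-identityˡ (detᴾ M) ⟨
      1ℤ * detᴾ M                     ≡⟨ cong (_* detᴾ M) detᴾ-L ⟨
      detᴾ L * detᴾ M                 ≡⟨ detᴾ-⊡ L M ⟨
      detᴾ (L ⊡ᴾ M)                   ≡⟨ detᴾ-cong factor ⟩
      detᴾ (X ⊡ᴾ Y₀)                  ≡⟨ detᴾ-⊡ X Y₀ ⟩
      detᴾ X * detᴾ Y₀                ≡⟨ cong₂ _*_ detᴾ-X detᴾ-Y₀ ⟩
      det Û * det K̂ ∎
      where
      detᴾ-Y₀ : detᴾ Y₀ ≡ det K̂
      detᴾ-Y₀ = begin
        detᴾ Y₀                  ≡⟨ *-identityʳ (detᴾ Y₀) ⟨
        detᴾ Y₀ * 1ℤ             ≡⟨ cong (detᴾ Y₀ *_) (trans (det-ᵀ λ u v → L (decode u) (decode v)) detᴾ-L) ⟨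
        detᴾ Y₀ * detᴾ (flip L)  ≡⟨ detᴾ-⊡ Y₀ (flip L) ⟨
        detᴾ (Y₀ ⊡ᴾ flip L)      ≡⟨ detᴾ-Y₀Lᵀ ⟩
        det K̂                    ∎

-- The group determinant of the chosen element

module GroupDeterminant {c ℓ : Level} {n′ : ℕ} (F : FiniteField c ℓ (suc (suc n′))) (u v : ℤ) where
  private
    N q : ℕ
    N = suc n′
    q = suc N
  open FiniteField F using (Carrier; _≈_; _≉_; 0#; 1#; invertible) renaming (_*_ to _*ᶠ_)
  private module F = FiniteField F
  open import Algebra.Properties.CommutativeSemiring.Exp F.commutativeSemiring using () renaming (_^_ to _^ᶠ_)
  open import Algebra.Properties.Group F.+-group using (x∙y⁻¹≈ε⇒x≈y)
  open CyclicUnits F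
  open AffineAction F
  open Affine
  open Group (GA₁ F) using (_∙_; _⁻¹) renaming (_≈_ to _≈ᴳ_; setoid to GA-setoid)
  open PairIndexed n′ q

  module _ (g : Carrier) (g≉0 : g ≉ 0#)
    (order : ∀ k → 0 ℕ.< k → k ℕ.< N → g ^ᶠ k ≉ 1#) where
    open PrimitiveRoot g g≉0 order

    point : Index → Affine F
    point (i , r) = withRoot (power i) (power≉0 i) (element r)

    point-injective : ∀ k h → point k ≈ᴳ point h → k ≡ h
    point-injective (i , r) (j , s) eq = cong₂ _,_ (power-injective (proj₁ eq))
      (element-injective (withRoot-injective {a≉0 = power≉0 i} {b≉0 = power≉0 j} eq))

    point-surjective : ∀ h → ∃ λ k → point k ≈ᴳ h
    point-surjective h with power-surjective (slope h) (slope≉0 h) | withRoot-surjective h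
    ... | i , gⁱ≈a | r , (_ , ar≈b) = (i , index r) , gⁱ≈a ,
      F.trans (F.-‿cong (F.*-cong gⁱ≈a (element-index r))) ar≈b

    enumerationᴳ : Enumeration (n′ ℕ.* q ℕ.+ q) GA-setoid
    enumerationᴳ = Bijection⇒Inverse record
      { to        = point ∘ decode
      ; cong      = λ { refl → F.refl , F.refl }
      ; bijective =
          (λ {x} {y} eq → trans (sym (encode-decode x))
            (trans (cong encode (point-injective (decode x) (decode y) eq)) (encode-decode y)))
        , λ h → encode (proj₁ (point-surjective h)) ,
            λ { refl → subst (λ k → point k ≈ᴳ h) (sym (decode-encode (proj₁ (point-surjective h))))
                (proj₂ (point-surjective h)) }
      }

    coefficient : Affine F → ℤ
    coefficient w =
      (⟦ slope w ≟ 1# ⟧ * ⟦ shift w ≟ 0# ⟧ - ⟦ slope w ≟ g ⟧ * ⟦ shift w ≟ 0# ⟧) +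
      (u * ⟦ apply w 1# ≟ 1# ⟧ + v * ⟦ apply w 0# ≟ 1# ⟧)

    ≟-cong : ∀ {x y} z → x ≈ y → ⟦ x ≟ z ⟧ ≡ ⟦ y ≟ z ⟧
    ≟-cong {x} {y} z x≈y = ⟦⟧-cong (x ≟ z) (y ≟ z) (F.trans (F.sym x≈y)) (F.trans x≈y)

    coefficient-cong : ∀ {w w′} → w ≈ᴳ w′ → coefficient w ≡ coefficient w′
    coefficient-cong {w} {w′} eq@(a≈a′ , b≈b′) = cong₂ _+_
      (cong₂ _-_ (cong₂ _*_ (≟-cong 1# a≈a′) (≟-cong 0# b≈b′)) (cong₂ _*_ (≟-cong g a≈a′) (≟-cong 0# b≈b′)))
      (cong₂ (λ x y → u * x + v * y)
        (≟-cong 1# (apply-cong {w} {w′} eq F.refl)) (≟-cong 1# (apply-cong {w} {w′} eq F.refl)))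

    α : GroupRing (GA₁ F)
    α = record { to = coefficient ; cong = λ {w} {w′} → coefficient-cong {w} {w′} }

    hits : Index → Carrier → Fin q → ℤ
    hits k y z = ⟦ apply (point k) (element z) ≟ y ⟧

    -- The indicator of point k = γ · point h.
    homothety : Carrier → PairMatrix
    homothety γ (i , r) (j , s) = δ r s * ⟦ power i ≟ γ *ᶠ power j ⟧

    S : PairMatrix
    S k h = homothety 1# k h - homothety g k h

    U : Index → Fin q → ℤ
    U k z = hits k 1# z

    K : Fin q → Index → ℤ
    K z h = u * hits h 1# z + v * hits h 0# z

    sum-hits : ∀ h y → sum (hits h y) ≡ 1ℤ
    sum-hits h y with apply-surjective (point h) y
    ... | x , hx≈y = sum-unique (λ z → apply (point h) (element z) ≟ y) (index x)
      (F.trans (apply-cong {point h} {point h} (F.refl , F.refl) (element-index x)) hx≈y)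
      (λ z hz≈y → trans (sym (index-element z))
        (index-cong (apply-injective (point h) (F.trans hz≈y (F.sym hx≈y)))))

    module _ {w k h} (eq : w ∙ point h ≈ᴳ point k) where

      homothety-quotient : ∀ γ → ⟦ slope w ≟ γ ⟧ * ⟦ shift w ≟ 0# ⟧ ≡ homothety γ k h
      homothety-quotient γ = ⟦⟧*⟦⟧-cong (slope w ≟ γ) (shift w ≟ 0#)
        (proj₂ k Fin.≟ proj₂ h) (power (proj₁ k) ≟ γ *ᶠ power (proj₁ h))
        (λ a≈γ b≈0 → let r≈s , p = homothety⇒ {a≉0 = power≉0 (proj₁ k)} {b≉0 = power≉0 (proj₁ h)} {w = w} eq a≈γ b≈0
                     in element-injective r≈s , p)
        (λ r≡s p → homothety⇐ {a≉0 = power≉0 (proj₁ k)} {b≉0 = power≉0 (proj₁ h)} {w = w} eq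
          (F.reflexive (cong element r≡s)) p)

      -- Exactly one z has h z = y, and for it k z = w (h z) = w y.
      sum-hits-quotient : ∀ y → sum (λ z → hits k 1# z * hits h y z) ≡ ⟦ apply w y ≟ 1# ⟧
      sum-hits-quotient y = begin
        sum (λ z → hits k 1# z * hits h y z)
          ≡⟨ sum-cong-≗ (λ z → ⟦⟧*⟦⟧-cong (apply (point k) (element z) ≟ 1#) (apply (point h) (element z) ≟ y)
               (apply w y ≟ 1#) (apply (point h) (element z) ≟ y)
               (λ kz≈1 hz≈y → F.trans (F.sym (kz≈wy z hz≈y)) kz≈1 , hz≈y)
               (λ wy≈1 hz≈y → F.trans (kz≈wy z hz≈y) wy≈1 , hz≈y)) ⟩
        sum (λ z → ⟦ apply w y ≟ 1# ⟧ * hits h y z)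
          ≡⟨ *-distribˡ-sum ⟦ apply w y ≟ 1# ⟧ (hits h y) ⟨
        ⟦ apply w y ≟ 1# ⟧ * sum (hits h y)
          ≡⟨ cong (⟦ apply w y ≟ 1# ⟧ *_) (sum-hits h y) ⟩
        ⟦ apply w y ≟ 1# ⟧ * 1ℤ
          ≡⟨ *-identityʳ _ ⟩
        ⟦ apply w y ≟ 1# ⟧ ∎
        where
        kz≈wy : ∀ z → apply (point h) (element z) ≈ y → apply (point k) (element z) ≈ apply w y
        kz≈wy z hz≈y = F.trans (F.sym (apply-cong {w ∙ point h} {point k} eq F.refl))
          (F.trans (apply-∘ w (point h) (element z)) (apply-cong {w} {w} (F.refl , F.refl) hz≈y))

      coefficient-quotient : coefficient w ≡ S k h + sum (λ z → U k z * K z h)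
      coefficient-quotient = cong₂ _+_
        (cong₂ _-_ (homothety-quotient 1#) (homothety-quotient g))
        (begin
          u * ⟦ apply w 1# ≟ 1# ⟧ + v * ⟦ apply w 0# ≟ 1# ⟧
            ≡⟨ cong₂ (λ x y → u * x + v * y) (sum-hits-quotient 1#) (sum-hits-quotient 0#) ⟨
          u * sum (λ z → hits k 1# z * hits h 1# z) + v * sum (λ z → hits k 1# z * hits h 0# z)
            ≡⟨ sum-linear₂ u v (λ z → hits k 1# z * hits h 1# z) (λ z → hits k 1# z * hits h 0# z) ⟨
          sum (λ z → u * (hits k 1# z * hits h 1# z) + v * (hits k 1# z * hits h 0# z))
            ≡⟨ sum-cong-≗ (λ z → identity u v (hits k 1# z) (hits h 1# z) (hits h 0# z)) ⟩
          sum (λ z → U k z * K z h) ∎)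
        where
        identity : ∀ u v a x y → u * (a * x) + v * (a * y) ≡ a * (u * x + v * y)
        identity = solve-∀

    -- Multiplication by γ permutes the units, so exactly one slope matches. The result does not
    -- depend on γ, which is why the two terms of `S` cancel in block sums.
    columnSum : ∀ {γ} → γ ≉ 0# → ∀ r h → sum (λ i → homothety γ (i , r) h) ≡ δ r (proj₂ h)
    columnSum {γ} γ≉0 r (j , s) with power-surjective (γ *ᶠ power j) (*-≉0 γ≉0 (power≉0 j))
    ... | i , gⁱ≈ = begin
      sum (λ i → δ r s * ⟦ power i ≟ γ *ᶠ power j ⟧)
        ≡⟨ *-distribˡ-sum (δ r s) (λ i → ⟦ power i ≟ γ *ᶠ power j ⟧) ⟨
      δ r s * sum (λ i → ⟦ power i ≟ γ *ᶠ power j ⟧)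
        ≡⟨ cong (δ r s *_) (sum-unique (λ i → power i ≟ γ *ᶠ power j) i gⁱ≈
             (λ i′ eq → power-injective (F.trans eq (F.sym gⁱ≈)))) ⟩
      δ r s * 1ℤ
        ≡⟨ *-identityʳ (δ r s) ⟩
      δ r s ∎

    rowSum : ∀ {γ} → γ ≉ 0# → ∀ k s → sum (λ j → homothety γ k (j , s)) ≡ δ (proj₂ k) s
    rowSum {γ} γ≉0 (i , r) s with invertible γ≉0
    ... | γ⁻¹ , γ⁻¹γ≈1 , γγ⁻¹≈1 with power-surjective (γ⁻¹ *ᶠ power i) (*-≉0 γ⁻¹≉0 (power≉0 i))
      where
      γ⁻¹≉0 : γ⁻¹ ≉ 0#
      γ⁻¹≉0 eq = 1≉0 (F.trans (F.sym γγ⁻¹≈1) (F.trans (F.*-congˡ eq) (F.zeroʳ γ)))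
    ...   | j , gʲ≈ = begin
      sum (λ j → δ r s * ⟦ power i ≟ γ *ᶠ power j ⟧)
        ≡⟨ *-distribˡ-sum (δ r s) (λ j → ⟦ power i ≟ γ *ᶠ power j ⟧) ⟨
      δ r s * sum (λ j → ⟦ power i ≟ γ *ᶠ power j ⟧)
        ≡⟨ cong (δ r s *_) (sum-unique (λ j → power i ≟ γ *ᶠ power j) j (F.sym γgʲ≈)
             (λ j′ eq → power-injective (*-cancelˡ γ≉0 (F.trans (F.sym eq) (F.sym γgʲ≈))))) ⟩
      δ r s * 1ℤ
        ≡⟨ *-identityʳ (δ r s) ⟩
      δ r s ∎
      where
      γgʲ≈ : γ *ᶠ power j ≈ power i
      γgʲ≈ = F.trans (F.*-congˡ gʲ≈) (F.trans (F.sym (F.*-assoc γ γ⁻¹ (power i)))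
        (F.trans (F.*-congʳ γγ⁻¹≈1) (F.*-identityˡ (power i))))

    S-columnSums : ∀ r h → sum (λ i → S (i , r) h) ≡ 0ℤ
    S-columnSums r h = begin
      sum (λ i → S (i , r) h)
        ≡⟨ sum-minus (λ i → homothety 1# (i , r) h) (λ i → homothety g (i , r) h) ⟩
      sum (λ i → homothety 1# (i , r) h) - sum (λ i → homothety g (i , r) h)
        ≡⟨ cong₂ _-_ (columnSum 1≉0 r h) (columnSum g≉0 r h) ⟩
      δ r (proj₂ h) - δ r (proj₂ h)
        ≡⟨ +-inverseʳ (δ r (proj₂ h)) ⟩
      0ℤ ∎

    S-rowSums : ∀ k s → sum (λ j → S k (j , s)) ≡ 0ℤ
    S-rowSums k s = begin
      sum (λ j → S k (j , s))
        ≡⟨ sum-minus (λ j → homothety 1# k (j , s)) (λ j → homothety g k (j , s)) ⟩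
      sum (λ j → homothety 1# k (j , s)) - sum (λ j → homothety g k (j , s))
        ≡⟨ cong₂ _-_ (rowSum 1≉0 k s) (rowSum g≉0 k s) ⟩
      δ (proj₂ k) s - δ (proj₂ k) s
        ≡⟨ +-inverseʳ (δ (proj₂ k) s) ⟩
      0ℤ ∎

    -- The cyclic shift by `g` wraps around only into the slope g⁰. With index 0 removed, equality
    -- would give 1 as the power of `g` with exponent j + 1 - i, which lies strictly between 0 and
    -- `N`.
    power-suc≉g*power-suc : ∀ {i j : Fin n′} → i Fin.≤ j → ¬ power (suc i) ≈ g *ᶠ power (suc j)
    power-suc≉g*power-suc {i} {j} i≤j eq =
      order (suc (toℕ j) ℕ.∸ toℕ i) (ℕ.m<n⇒0<n∸m (ℕ.s<s i≤j))
        (ℕ.≤-<-trans (ℕ.m∸n≤m (suc (toℕ j)) (toℕ i)) (ℕ.s<s (Fin.toℕ<n j)))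
        (^-cancel {g} {suc (toℕ i)} {suc (suc (toℕ j))} g≉0 (ℕ.m≤n⇒m≤1+n (ℕ.s≤s i≤j)) eq)

    S-diag : ∀ i r → S (suc i , r) (suc i , r) ≡ 1ℤ
    S-diag i r = cong₂ _-_
      (cong₂ _*_ (δ-refl r) (⟦⟧-true (power (suc i) ≟ 1# *ᶠ power (suc i)) (F.sym (F.*-identityˡ _))))
      (cong₂ _*_ (δ-refl r) (⟦⟧-false (power (suc i) ≟ g *ᶠ power (suc i)) (power-suc≉g*power-suc {i} {i} ℕ.≤-refl)))

    S-upper : ∀ i j r s → i Fin.< j → S (suc i , r) (suc j , s) ≡ 0ℤ
    S-upper i j r s i<j = begin
      S (suc i , r) (suc j , s)
        ≡⟨ cong₂ (λ x y → δ r s * x - δ r s * y)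
             (⟦⟧-false (power (suc i) ≟ 1# *ᶠ power (suc j)) (λ eq →
               Fin.<⇒≢ i<j (Fin.suc-injective (power-injective (F.trans eq (F.*-identityˡ _))))))
             (⟦⟧-false (power (suc i) ≟ g *ᶠ power (suc j)) (power-suc≉g*power-suc {i} {j} (ℕ.<⇒≤ i<j))) ⟩
      δ r s * 0ℤ - δ r s * 0ℤ
        ≡⟨ +-inverseʳ (δ r s * 0ℤ) ⟩
      0ℤ ∎

    S-block : ∀ i r s → r ≢ s → S (suc i , r) (suc i , s) ≡ 0ℤ
    S-block i r s r≢s = cong
      (λ d → d * ⟦ power (suc i) ≟ 1# *ᶠ power (suc i) ⟧ - d * ⟦ power (suc i) ≟ g *ᶠ power (suc i) ⟧) (δ-≢ r≢s)

    -- A map with root r and slope a sends z to a (z - r). For z ≠ r this is 1 exactly for the slope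
    -- inverse to z - r; for z = r it is never 1.
    sum-hits₁ : ∀ r z → sum (λ i → hits (i , r) 1# z) ≡ 1ℤ + -1ℤ * δ r z
    sum-hits₁ r z with r Fin.≟ z
    ... | yes refl = sum-zero (λ i → hits (i , r) 1# r) (λ i → ⟦⟧-false (apply (point (i , r)) (element r) ≟ 1#)
      (λ eq → F.0≉1 (F.trans (F.sym (apply-root (power i) {power≉0 i} (element r))) eq)))
    ... | no r≢z with invertible {element z F.- element r} (λ eq → r≢z (sym (element-injective (x∙y⁻¹≈ε⇒x≈y _ _ eq))))
    ...   | b , ba≈1 , ab≈1 with power-surjective b
      (λ b≈0 → 1≉0 (F.trans (F.sym ab≈1) (F.trans (F.*-congˡ b≈0) (F.zeroʳ _))))
    ...     | i , gⁱ≈b = sum-unique (λ i → apply (point (i , r)) (element z) ≟ 1#) i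
      (F.trans (apply-withRoot (power i) {power≉0 i} (element r) (element z)) (F.trans (F.*-congʳ gⁱ≈b) ba≈1))
      (λ j eq → power-injective (*-cancelˡ a≉0 (a*power≈ j eq)))
      where
      a = element z F.- element r
      a≉0 : a ≉ 0#
      a≉0 a≈0 = 1≉0 (F.trans (F.sym ba≈1) (F.trans (F.*-congˡ a≈0) (F.zeroʳ b)))
      a*power≈ : ∀ j → apply (point (j , r)) (element z) ≈ 1# → a *ᶠ power j ≈ a *ᶠ power i
      a*power≈ j eq = F.trans (F.*-comm a (power j)) (F.trans
        (F.sym (apply-withRoot (power j) {power≉0 j} (element r) (element z)))
        (F.trans eq (F.trans (F.sym ab≈1) (F.*-congˡ (F.sym gⁱ≈b)))))

    -- A map with root r vanishes at r only, whichever of the `N` slopes it has.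
    sum-hits₀ : ∀ r z → sum (λ i → hits (i , r) 0# z) ≡ Int.+ N * δ r z
    sum-hits₀ r z with r Fin.≟ z
    ... | yes refl = trans
      (sum-1 N (λ i → hits (i , r) 0# r) (λ i → ⟦⟧-true (apply (point (i , r)) (element r) ≟ 0#)
        (apply-root (power i) {power≉0 i} (element r))))
      (sym (*-identityʳ (Int.+ N)))
    ... | no r≢z = trans
      (sum-zero (λ i → hits (i , r) 0# z) (λ i → ⟦⟧-false (apply (point (i , r)) (element z) ≟ 0#)
        (λ eq → r≢z (sym (element-injective (apply≈0⇒root (power i) {power≉0 i} (element r) (element z) eq))))))
      (sym (*-zeroʳ (Int.+ N)))

    det-Û : det {q} (λ r z → sum λ i → U (i , r) z) ≡ -1ℤ ^ N * (-1ℤ + Int.+ q * 1ℤ)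
    det-Û = trans (det-cong sum-hits₁) (det-constant+scalar N 1ℤ -1ℤ)

    det-K̂ : det {q} (λ z s → sum λ j → K z (j , s)) ≡
            (Int.+ N * v - u) ^ N * ((Int.+ N * v - u) + Int.+ q * u)
    det-K̂ = trans (det-cong K̂≡) (det-constant+scalar N u (Int.+ N * v - u))
      where
      identity : ∀ u v n d → u * (1ℤ + -1ℤ * d) + v * (n * d) ≡ u + (n * v - u) * d
      identity = solve-∀
      K̂≡ : ∀ z s → sum (λ j → K z (j , s)) ≡ u + (Int.+ N * v - u) * δ z s
      K̂≡ z s = begin
        sum (λ j → K z (j , s))
          ≡⟨ sum-linear₂ u v (λ j → hits (j , s) 1# z) (λ j → hits (j , s) 0# z) ⟩
        u * sum (λ j → hits (j , s) 1# z) + v * sum (λ j → hits (j , s) 0# z)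
          ≡⟨ cong₂ (λ x y → u * x + v * y) (sum-hits₁ s z) (sum-hits₀ s z) ⟩
        u * (1ℤ + -1ℤ * δ s z) + v * (Int.+ N * δ s z)
          ≡⟨ identity u v (Int.+ N) (δ s z) ⟩
        u + (Int.+ N * v - u) * δ s z
          ≡⟨ cong (λ d → u + (Int.+ N * v - u) * d) (δ-sym s z) ⟩
        u + (Int.+ N * v - u) * δ z s ∎

    private
      M : PairMatrix
      M k h = S k h + sum λ z → U k z * K z h

      detᴾ-coefficient : detᴾ (λ k h → coefficient (point k ∙ point h ⁻¹)) ≡ detᴾ M
      detᴾ-coefficient = detᴾ-cong {X = λ k h → coefficient (point k ∙ point h ⁻¹)} {Y = M}
        (λ k h → coefficient-quotient {point k ∙ point h ⁻¹} {k} {h} (quotient-∙ (point k) (point h)))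

      detᴾ-M : detᴾ M ≡ det {q} (λ r z → sum λ i → U (i , r) z) * det {q} (λ z s → sum λ j → K z (j , s))
      detᴾ-M = detᴾ-reduce S U K S-columnSums S-rowSums S-diag S-upper S-block

      d = Int.+ N * v - u

      -- The eigenvalues of Û and K̂ on the constant vector are -1 + q = N and d + q u = N (u + v).
      -- The sign (-1)^N from Û turns d^N into (u - N v)^N.
      simplify : (-1ℤ ^ N * (-1ℤ + Int.+ q * 1ℤ)) * (d ^ N * (d + Int.+ q * u)) ≡
                 (Int.+ N * (Int.+ N * (u + v))) * (u - Int.+ N * v) ^ N
      simplify = trans (identity₁ (-1ℤ ^ N) (d ^ N) (Int.+ N) u v)
                       (cong (Int.+ N * (Int.+ N * (u + v)) *_) (negate N))
        where
        identity₁ : ∀ a b n u v → (a * (-1ℤ + (1ℤ + n) * 1ℤ)) * (b * ((n * v - u) + (1ℤ + n) * u)) ≡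
                                  (n * (n * (u + v))) * (a * b)
        identity₁ = solve-∀
        identity₂ : ∀ a b n u v → (-1ℤ * a) * ((n * v - u) * b) ≡ (u - n * v) * (a * b)
        identity₂ = solve-∀
        negate : ∀ m → -1ℤ ^ m * d ^ m ≡ (u - Int.+ N * v) ^ m
        negate zero    = refl
        negate (suc m) = trans (identity₂ (-1ℤ ^ m) (d ^ m) (Int.+ N) u v) (cong ((u - Int.+ N * v) *_) (negate m))

      detᴾ-value : detᴾ M ≡ (Int.+ N * (Int.+ N * (u + v))) * (u - Int.+ N * v) ^ N
      detᴾ-value = trans detᴾ-M (trans (cong₂ _*_ det-Û det-K̂) simplify)

    detᴾ≡⇒isDeterminant : ∀ D → detᴾ M ≡ D → IsIntegerGroupDeterminant (GA₁ F) D
    detᴾ≡⇒isDeterminant D eq = n′ ℕ.* q ℕ.+ q , enumerationᴳ , α ,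
      trans (sym eq) (sym detᴾ-coefficient)

    isDeterminant : IsIntegerGroupDeterminant (GA₁ F) ((Int.+ N * (Int.+ N * (u + v))) * (u - Int.+ N * v) ^ N)
    isDeterminant = detᴾ≡⇒isDeterminant _ detᴾ-value

  isIntegerGroupDeterminant :
    IsIntegerGroupDeterminant (GA₁ F) ((Int.+ N * (Int.+ N * (u + v))) * (u - Int.+ N * v) ^ N)
  isIntegerGroupDeterminant = let g , g≉0 , order = primitiveRoot in isDeterminant g g≉0 order

-- Matching A and B with the parameters u and v

open import Data.Integer.Base using (+_)
open import Data.Integer.Divisibility.Signed using (_∣_; divides)

theorem3 : ∀ {c ℓ} (p k q : ℕ) → Prime p → k ≥ 1 → q ≡ p ℕ.^ k →
    (F : FiniteField c ℓ q) (A B : ℤ) →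
    (+ ((q ∸ 1) ℕ.^ 2)) ∣ A → (+ q) ∣ (B - A) →
    IsIntegerGroupDeterminant (GA₁ F) (A * B ^ (q ∸ 1))
-- A field has the distinct elements 0 and 1, which rules out q < 2.
theorem3 _ _ zero _ _ _ F _ _ _ _ = contradiction (FieldProperties.index F (FiniteField.0# F)) Fin.¬Fin0
theorem3 _ _ (suc zero) _ _ _ F _ _ _ _ = contradiction (index-injective (index≡ (index 0#) (index 1#))) 0≉1
  where
  open FiniteField F using (0#; 1#; 0≉1)
  open FieldProperties F
  index≡ : (i j : Fin 1) → i ≡ j
  index≡ zero zero = refl
-- With N = q − 1, A = m N² and B − A = t q, take u + v = m and v = − T; then u − N v = m + q T, which is B.
theorem3 _ _ (suc (suc n′)) _ _ _ F A B (divides m A≡m*n²) (divides t B-A≡t*q) =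
  subst (IsIntegerGroupDeterminant (GA₁ F)) (cong₂ (λ x y → x * y ^ N) A≡ B≡)
    (GroupDeterminant.isIntegerGroupDeterminant F (m + T) (- T))
  where
  N = suc n′
  -- Since N² = 1 + (N - 1) q, the number B = m N² + t q equals m + (m (N - 1) + t) q.
  T = m * ((+ N) - 1ℤ) + t
  A≡n : A ≡ m * ((+ N) * (+ N))
  A≡n = trans A≡m*n² (cong (m *_) (trans (cong (λ x → + (N ℕ.* x)) (ℕ.*-identityʳ N)) (pos-* N N)))
  identity₁ : ∀ n m T → n * (n * ((m + T) + - T)) ≡ m * (n * n)
  identity₁ = solve-∀
  A≡ : (+ N) * ((+ N) * ((m + T) + - T)) ≡ A
  A≡ = trans (identity₁ (+ N) m T) (sym A≡n)
  identity₂ : ∀ n m t → (m + (m * (n - 1ℤ) + t)) - n * - (m * (n - 1ℤ) + t) ≡ t * (1ℤ + n) + m * (n * n)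
  identity₂ = solve-∀
  identity₃ : ∀ A B → (B - A) + A ≡ B
  identity₃ = solve-∀
  B≡ : (m + T) - (+ N) * - T ≡ B
  B≡ = trans (identity₂ (+ N) m t) (trans (cong₂ Int._+_ (sym B-A≡t*q) (sym A≡n)) (identity₃ A B))
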